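{- Let $\alpha$, $\delta$, $\psi$, $\omega$ denote the Niemeier lattices with root systems $D_{24}$, $A_{24}$, $A_1^{24}$, and the Leech lattice, respectively. (1) $\varTheta(\vartheta_\alpha^{(2)})\equiv\varTheta(\vartheta_\delta^{(2)})\equiv\varTheta(\vartheta_\psi^{(2)})\equiv\varTheta(\vartheta_\omega^{(2)})\equiv0\pmod{23}$. (2) Each of $\vartheta_\alpha^{(3)}$, $\vartheta_\delta^{(3)}$, $\vartheta_\psi^{(3)}$, $\vartheta_\omega^{(3)}$ is a mod 23 singular modular form with nontrivial maximal 23-rank 2.
   Context: For a lattice with Gram matrix $S$ of rank 24, $\vartheta^{(n)}(Z)=\sum_{X\in M_{24,n}(\mathbb{Z})}\exp(\pi\sqrt{ -1}\,\mathrm{tr}({}^tXSXZ))=\sum_T a(\vartheta^{(n)};T)\exp(2\pi\sqrt{ -1}\mathrm{tr}(TZ))$, $T$ over positive semidefinite $T\in\mathrm{Sym}_n^*(\mathbb{Z})=\{T\in\mathrm{Sym}_n(\mathbb{Q}):t_{ii},2t_{ij}\in\mathbb{Z}\}$; these are Siegel modular forms of weight 12 for $Sp_n(\mathbb{Z})$ with integral coefficients. A Niemeier lattice is a positive definite even unimodular lattice of rank 24. The theta operator is defined on formal Fourier expansions by $\varTheta(\sum a(F;T)q^T)=\sum a(F;T)\det(T)q^T$; a congruence $G\equiv0\pmod p$ of formal expansions means all coefficients are divisible by $p$. For a prime $p$, a modular form $F\in M_k(Sp_n(\mathbb{Z}))$ with $p$-integral coefficients is a mod $p$ singular modular form with (nontrivial)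 maximal $p$-rank $r<n$ if $a(F;T)\equiv0\pmod p$ for all $T$ with $r+1\le\mathrm{rank}(T)\le n$, and $a(F;T)\not\equiv0\pmod p$ for some $T$ with $\mathrm{rank}(T)=r$. -}

module Defs where

open import Data.Bool using (Bool; true; false; _∧_; _∨_; _xor_; if_then_else_; not)
open import Data.Nat as ℕ using (ℕ; zero; suc; _<_; _≤_)
open import Data.Integer as ℤ using (ℤ; +_; -_; _%ℕ_)
open import Data.Fin using (Fin; zero; suc; toℕ; punchIn)
open import Data.Vec as V using (Vec; []; _∷_; lookup)
open import Data.List as L using (List; []; _∷_; concatMap; allFin)
open import Data.Product using (Σ; _×_; ∃; ∃-syntax)
open import Relation.Nullary using (¬_; Dec; yes; no)
open import Relation.Nullary.Decidable using (⌊_⌋)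
open import Relation.Binary.PropositionalEquality using (_≡_; _≢_)
open import Data.Bool.ListAction using (any)
open import Data.Nat.Divisibility as ND using ()
open import Data.Integer.Divisibility as ZD using ()

Σℤ : ∀ {n} → (Fin n → ℤ) → ℤ
Σℤ {zero}  f = + 0
Σℤ {suc n} f = f zero ℤ.+ Σℤ (λ i → f (suc i))

allF : ∀ {n} → (Fin n → Bool) → Bool
allF {zero}  f = true
allF {suc n} f = f zero ∧ allF (λ i → f (suc i))

infix 4 _==ℤ_ _==ℕ_

_==ℤ_ : ℤ → ℤ → Bool
x ==ℤ y = ⌊ x ℤ.≟ y ⌋

_==ℕ_ : ℕ → ℕ → Bool
x ==ℕ y = ⌊ x ℕ.≟ y ⌋

count : ∀ {A : Set} → (A → Bool) → List A → ℕ
count f []       = 0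
count f (x ∷ xs) = if f x then suc (count f xs) else count f xs

Mat : ℕ → Set
Mat n = Fin n → Fin n → ℤ

sgn : ℕ → ℤ
sgn zero          = + 1
sgn (suc zero)    = - (+ 1)
sgn (suc (suc k)) = sgn k

det : ∀ n → Mat n → ℤ
det zero    M = + 1
det (suc n) M = Σℤ (λ j → sgn (toℕ j) ℤ.* (M zero j ℤ.* det n (λ i k → M (suc i) (punchIn j k))))

-- M has a nonzero r×r minor (rows f, columns g).  Non-injective choices of f or g
-- give a zero determinant, so this is exactly "some r×r minor is nonzero".
NonzeroMinor : ∀ n → Mat n → ℕ → Set
NonzeroMinor n M r = Σ (Fin r → Fin n) λ f → Σ (Fin r → Fin n) λ g →
  det r (λ i j → M (f i) (g j)) ≢ + 0

Rank : ∀ n → Mat n → ℕ → Set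
Rank n M r = NonzeroMinor n M r × (∀ s → r < s → s ≤ n → ¬ NonzeroMinor n M s)

-- Half-integral matrices T ∈ Sym_n^*(ℤ), represented by M = 2T
-- (an integral symmetric matrix with even diagonal).

record HalfIntegral (n : ℕ) : Set where
  constructor mkHI
  field
    twice     : Mat n
    symmetric : ∀ i j → twice i j ≡ twice j i
    evenDiag  : ∀ i → twice i i %ℕ 2 ≡ 0
open HalfIntegral public

-- positive semidefinite (x ranging over ℤ^n, equivalently over ℚ^n or ℝ^n)
PSD : ∀ {n} → HalfIntegral n → Set
PSD {n} T = ∀ (x : Fin n → ℤ) →
  + 0 ℤ.≤ Σℤ (λ i → Σℤ (λ j → x i ℤ.* (twice T i j ℤ.* x j)))

rankT : ∀ {n} → HalfIntegral n → ℕ → Set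
rankT {n} T r = Rank n (twice T) r

-- Lattices given by a coordinate model: L = { x/√c : x ∈ ℤ^d, mem x = true },
-- with inner product ⟨x,y⟩ = (x·y)/c.

record LatticeModel : Set where
  constructor lattice
  field
    dim   : ℕ
    scale : ℕ
    mem   : Vec ℤ dim → Bool
open LatticeModel public

dot : ∀ {d} → Vec ℤ d → Vec ℤ d → ℤ
dot xs ys = V.foldr _ ℤ._+_ (+ 0) (V.zipWith ℤ._*_ xs ys)

range : ℕ → List ℤ
range B = L.map (λ k → + k) (L.upTo (suc B)) L.++ L.map (λ k → - (+ suc k)) (L.upTo B)

box : ∀ d → ℕ → List (Vec ℤ d)
box zero    B = [] ∷ []
box (suc d) B = concatMap (λ x → L.map (x ∷_) (box d B)) (range B)

tuples : ∀ {A : Set} n → List A → List (Vec A n)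
tuples zero    xs = [] ∷ []
tuples (suc n) xs = concatMap (λ x → L.map (x ∷_) (tuples n xs)) xs

trace2 : ∀ {n} → HalfIntegral n → ℕ
trace2 {n} T = ℤ.∣ Σℤ (λ i → twice T i i) ∣

-- Fourier coefficient a(ϑ_L^{(n)}; T) = #{ X ∈ M_{rank,n}(ℤ) : ᵗX S X = 2T }
--   = #{ (v_1,…,v_n) ∈ L^n : ⟨v_i,v_j⟩ = (2T)_{ij} }.
-- Every such v_i has x·x = c·(2T)_{ii}, so each coordinate satisfies |x_k| ≤ c·tr(2T)
-- (for PSD T); the enumeration box therefore contains all solutions.
thetaCoeff : (L : LatticeModel) → ∀ {n} → HalfIntegral n → ℕ
thetaCoeff L {n} T =
  count (λ vs → allF (λ i → mem L (lookup vs i))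
              ∧ allF (λ i → allF (λ j →
                  dot (lookup vs i) (lookup vs j) ==ℤ (+ scale L ℤ.* twice T i j))))
        (tuples n (box (dim L) (scale L ℕ.* trace2 T)))

-- The extended binary Golay code: the extended quadratic-residue code of length 24,
-- generated by the 12 cyclic shifts of g(x) = 1 + x² + x⁴ + x⁵ + x⁶ + x¹⁰ + x¹¹
-- (plus an overall parity bit).

bits : List ℕ → List Bool
bits = L.map (λ k → k ==ℕ 1)

golayGenerators : List (List Bool)
golayGenerators = L.map bits
  ( (1 ∷ 0 ∷ 1 ∷ 0 ∷ 1 ∷ 1 ∷ 1 ∷ 0 ∷ 0 ∷ 0 ∷ 1 ∷ 1 ∷ 0 ∷ 0 ∷ 0 ∷ 0 ∷ 0 ∷ 0 ∷ 0 ∷ 0 ∷ 0 ∷ 0 ∷ 0 ∷ 1 ∷ [])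
  ∷ (0 ∷ 1 ∷ 0 ∷ 1 ∷ 0 ∷ 1 ∷ 1 ∷ 1 ∷ 0 ∷ 0 ∷ 0 ∷ 1 ∷ 1 ∷ 0 ∷ 0 ∷ 0 ∷ 0 ∷ 0 ∷ 0 ∷ 0 ∷ 0 ∷ 0 ∷ 0 ∷ 1 ∷ [])
  ∷ (0 ∷ 0 ∷ 1 ∷ 0 ∷ 1 ∷ 0 ∷ 1 ∷ 1 ∷ 1 ∷ 0 ∷ 0 ∷ 0 ∷ 1 ∷ 1 ∷ 0 ∷ 0 ∷ 0 ∷ 0 ∷ 0 ∷ 0 ∷ 0 ∷ 0 ∷ 0 ∷ 1 ∷ [])
  ∷ (0 ∷ 0 ∷ 0 ∷ 1 ∷ 0 ∷ 1 ∷ 0 ∷ 1 ∷ 1 ∷ 1 ∷ 0 ∷ 0 ∷ 0 ∷ 1 ∷ 1 ∷ 0 ∷ 0 ∷ 0 ∷ 0 ∷ 0 ∷ 0 ∷ 0 ∷ 0 ∷ 1 ∷ [])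
  ∷ (0 ∷ 0 ∷ 0 ∷ 0 ∷ 1 ∷ 0 ∷ 1 ∷ 0 ∷ 1 ∷ 1 ∷ 1 ∷ 0 ∷ 0 ∷ 0 ∷ 1 ∷ 1 ∷ 0 ∷ 0 ∷ 0 ∷ 0 ∷ 0 ∷ 0 ∷ 0 ∷ 1 ∷ [])
  ∷ (0 ∷ 0 ∷ 0 ∷ 0 ∷ 0 ∷ 1 ∷ 0 ∷ 1 ∷ 0 ∷ 1 ∷ 1 ∷ 1 ∷ 0 ∷ 0 ∷ 0 ∷ 1 ∷ 1 ∷ 0 ∷ 0 ∷ 0 ∷ 0 ∷ 0 ∷ 0 ∷ 1 ∷ [])
  ∷ (0 ∷ 0 ∷ 0 ∷ 0 ∷ 0 ∷ 0 ∷ 1 ∷ 0 ∷ 1 ∷ 0 ∷ 1 ∷ 1 ∷ 1 ∷ 0 ∷ 0 ∷ 0 ∷ 1 ∷ 1 ∷ 0 ∷ 0 ∷ 0 ∷ 0 ∷ 0 ∷ 1 ∷ [])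
  ∷ (0 ∷ 0 ∷ 0 ∷ 0 ∷ 0 ∷ 0 ∷ 0 ∷ 1 ∷ 0 ∷ 1 ∷ 0 ∷ 1 ∷ 1 ∷ 1 ∷ 0 ∷ 0 ∷ 0 ∷ 1 ∷ 1 ∷ 0 ∷ 0 ∷ 0 ∷ 0 ∷ 1 ∷ [])
  ∷ (0 ∷ 0 ∷ 0 ∷ 0 ∷ 0 ∷ 0 ∷ 0 ∷ 0 ∷ 1 ∷ 0 ∷ 1 ∷ 0 ∷ 1 ∷ 1 ∷ 1 ∷ 0 ∷ 0 ∷ 0 ∷ 1 ∷ 1 ∷ 0 ∷ 0 ∷ 0 ∷ 1 ∷ [])
  ∷ (0 ∷ 0 ∷ 0 ∷ 0 ∷ 0 ∷ 0 ∷ 0 ∷ 0 ∷ 0 ∷ 1 ∷ 0 ∷ 1 ∷ 0 ∷ 1 ∷ 1 ∷ 1 ∷ 0 ∷ 0 ∷ 0 ∷ 1 ∷ 1 ∷ 0 ∷ 0 ∷ 1 ∷ [])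
  ∷ (0 ∷ 0 ∷ 0 ∷ 0 ∷ 0 ∷ 0 ∷ 0 ∷ 0 ∷ 0 ∷ 0 ∷ 1 ∷ 0 ∷ 1 ∷ 0 ∷ 1 ∷ 1 ∷ 1 ∷ 0 ∷ 0 ∷ 0 ∷ 1 ∷ 1 ∷ 0 ∷ 1 ∷ [])
  ∷ (0 ∷ 0 ∷ 0 ∷ 0 ∷ 0 ∷ 0 ∷ 0 ∷ 0 ∷ 0 ∷ 0 ∷ 0 ∷ 1 ∷ 0 ∷ 1 ∷ 0 ∷ 1 ∷ 1 ∷ 1 ∷ 0 ∷ 0 ∷ 0 ∷ 1 ∷ 1 ∷ 1 ∷ [])
  ∷ [])

xorList : List Bool → List Bool → List Bool
xorList = L.zipWith _xor_

zero24 : List Bool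
zero24 = L.replicate 24 false

spanList : List (List Bool) → List (List Bool)
spanList []       = zero24 ∷ []
spanList (g ∷ gs) = concatMap (λ w → w ∷ xorList g w ∷ []) (spanList gs)

golayCode : List (List Bool)
golayCode = spanList golayGenerators

eqBits : List Bool → List Bool → Bool
eqBits []       []       = true
eqBits (a ∷ as) (b ∷ bs) = (if a then b else not b) ∧ eqBits as bs
eqBits _        _        = false

inGolay : List Bool → Bool
inGolay w = any (eqBits w) golayCode

sumV : ∀ {d} → Vec ℤ d → ℤ
sumV = V.foldr _ ℤ._+_ (+ 0)

allV : ∀ {d} → (ℤ → Bool) → Vec ℤ d → Bool
allV p = V.foldr _ (λ x b → p x ∧ b) true

-- α : root system D24.  D24⁺ = D24 ∪ (D24 + (½)^24), scaled by 2:
-- x ∈ ℤ^24 with all coordinates of the same parity and Σ x ≡ 0 (mod 4); ⟨x,y⟩ = x·y/4.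
memD24 : Vec ℤ 24 → Bool
memD24 x@(x₀ ∷ _) = allV (λ xi → (xi %ℕ 2) ==ℕ (x₀ %ℕ 2)) x ∧ ((sumV x %ℕ 4) ==ℕ 0)

latticeα : LatticeModel
latticeα = lattice 24 4 memD24

-- δ : root system A24.  A24 ∪ glue generated by [5], scaled by 5:
-- y ∈ ℤ^25 with Σ y = 0 and all y_i congruent mod 5; ⟨y,z⟩ = y·z/25.
memA24 : Vec ℤ 25 → Bool
memA24 y@(y₀ ∷ _) = (sumV y ==ℤ + 0) ∧ allV (λ yi → (yi %ℕ 5) ==ℕ (y₀ %ℕ 5)) y

latticeδ : LatticeModel
latticeδ = lattice 25 25 memA24

-- ψ : root system A1^24.  x ∈ ℤ^24 with (x mod 2) ∈ Golay code; ⟨x,y⟩ = x·y/2.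
memA1 : Vec ℤ 24 → Bool
memA1 x = inGolay (V.toList (V.map (λ xi → (xi %ℕ 2) ==ℕ 1) x))

latticeψ : LatticeModel
latticeψ = lattice 24 2 memA1

-- ω : the Leech lattice (Conway's coordinates, scaled by √8):
-- x ∈ ℤ^24 with x ≡ m·𝟏 (mod 2), Σ x ≡ 4m (mod 8), and ((x − m·𝟏)/2 mod 2) ∈ Golay code;
-- ⟨x,y⟩ = x·y/8.
memLeech : Vec ℤ 24 → Bool
memLeech x@(x₀ ∷ _) =
  allV (λ xi → (xi %ℕ 2) ==ℕ m) x
  ∧ (((sumV x ℤ.- (+ (4 ℕ.* m))) %ℕ 8) ==ℕ 0)
  ∧ inGolay (V.toList (V.map (λ xi → ((xi ℤ.- + m) %ℕ 4) ==ℕ 2) x))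
  where m = x₀ %ℕ 2

latticeω : LatticeModel
latticeω = lattice 24 8 memLeech

-- Theta operator congruence in degree n:  Θ(ϑ_L^{(n)}) ≡ 0 (mod p), i.e.
-- p | a(T)·det(T) in ℤ_(p) for all T.  Since det(2T) = 2^n det(T), for odd p
-- this is p | a(T)·det(2T) in ℤ.
ThetaOpVanishesMod : ℕ → LatticeModel → ℕ → Set
ThetaOpVanishesMod p L n = ∀ (T : HalfIntegral n) → PSD T →
  (+ p) ZD.∣ ((+ thetaCoeff L T) ℤ.* det n (twice T))

SingularModWithMaxRank : ℕ → LatticeModel → ℕ → ℕ → Set
SingularModWithMaxRank p L n r =
  r < n
  × (∀ (T : HalfIntegral n) → PSD T → ∀ s → rankT T s → suc r ≤ s → s ≤ n →
       p ND.∣ thetaCoeff L T)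
  × (Σ (HalfIntegral n) λ T → (PSD T × rankT T r × ¬ (p ND.∣ thetaCoeff L T)))

{-# OPTIONS --safe #-}
module Submission where

open import Defs
open import Data.Bool using (Bool; true; false; T; _∧_; _xor_)
open import Data.Bool.ListAction using (any)
import Data.Bool.Properties as Bool
open import Data.Fin using (Fin; zero; suc; toℕ; fromℕ; inject₁; punchIn)
open import Data.Fin.Properties using (injective⇒≤; toℕ-injective; toℕ<n; toℕ-fromℕ; toℕ-inject₁)
open import Data.Integer as ℤ using (ℤ; +_; -[1+_]; -1ℤ; -_; _+_; _*_; _-_; ∣_∣; _≤_; _%ℕ_; _/ℕ_)
open import Data.Integer.DivMod using (a≡a%ℕn+[a/ℕn]*n; n%ℕd<d)
import Data.Integer.Properties as ℤ
open import Algebra.Properties.AbelianGroup ℤ.+-0-abelianGroup using () renaming (∙-cancelˡ to +-cancelˡ)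
open import Data.Integer.Solver using (module +-*-Solver)
open import Data.Integer.Tactic.RingSolver using (solve-∀)
open import Data.List as List using (List; []; _∷_; length; filter; concatMap; cartesianProductWith)
open import Data.List.Membership.Propositional using (_∈_; find)
open import Data.List.Membership.Propositional.Properties
import Data.List.Membership.DecPropositional as DecMembership
import Data.List.Membership.Setoid.Properties as Membership
open import Data.List.Properties using (length-tabulate; length-zipWith)
open import Data.List.Relation.Binary.Subset.Propositional using (_⊆_)
open import Data.List.Relation.Unary.All as ListAll using ([]; _∷_)
open import Data.List.Relation.Unary.AllPairs using ([]; _∷_)
open import Data.List.Relation.Unary.Any as Any using (here; there; index)
import Data.List.Relation.Unary.Any.Properties as Any
open import Data.List.Relation.Unary.Unique.Propositional using (Unique)
import Data.List.Relation.Unary.Unique.Propositional.Properties as Unique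
open import Data.Nat as ℕ using (ℕ; zero; suc; z≤n; s≤s)
open import Data.Nat.Coprimality using (Coprime; coprime⇒GCD≡1; prime⇒coprime)
import Data.Nat.Divisibility as ℕ
open import Data.Nat.GCD using (module Bézout)
open import Data.Nat.Primality using (Prime; prime?)
import Data.Nat.Properties as ℕ
open import Data.Product using (∃; ∃₂; _×_; _,_; proj₁; proj₂)
open import Data.Sum using (_⊎_; inj₁; inj₂; [_,_]′)
open import Data.Vec as Vec using (Vec; []; _∷_; _++_; lookup; replicate; toList)
import Data.Vec.Properties as Vecₚ
open import Data.Vec.Relation.Unary.All as All using (All; []; _∷_)
import Data.Vec.Relation.Unary.All.Properties as All
open import Function using (_∘_; id)
open import Function.Bundles using (Equivalence)
import Function.Endo.Propositional as Endo
open import Level using (0ℓ)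
open import Relation.Binary using (DecidableEquality; tri<; tri≈; tri>)
open import Relation.Binary.PropositionalEquality
open import Relation.Nullary using (¬_; Dec; yes; no; does; contradiction)
open import Relation.Nullary.Decidable using (⌊_⌋; from-yes; ¬?)
open import Relation.Unary using (Pred; Decidable)

-- Each of the four lattices has an isometry of order 23, permuting 23 coordinates cyclically (for ψ and ω
-- because the Golay code is cyclic).  It acts on the solutions counted by a(ϑ;T), so modulo 23 only fixed
-- solutions count.  The fixed sublattice is binary of determinant 23, with Gram matrix (4 1; 1 6) for α, ω
-- and (2 1; 1 12) for δ, ψ.  Hence a fixed solution forces det(2T) = 23 m² in degree 2 and det(2T) = 0 in
-- degree 3.  Conversely, for T the Gram matrix of a basis of the fixed sublattice bordered by zeros, the
-- fixed solutions are non-empty and few (at most 12), so their number is prime to 23.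

-- The coefficient is a count over an astronomically large coordinate box, so it is never evaluated.
-- Everything is argued on duplicate-free lists, whose lengths are compared through inclusions.
--
-- Rotating coordinates suits this count because it maps the box to itself, besides preserving inner
-- product and membership. It also makes fixed vectors explicit: 23 equal entries followed by one
-- free entry, or by two in the 25-coordinate model of `δ`, where the zero sum removes one degree of
-- freedom. Describing the fixed sublattice thus amounts to solving the membership congruences for
-- the last coordinates. `CyclicIsometry` isolates what must be checked for each lattice.

-- Duplicate-free lists and iterates of a map

module _ {A : Set} where

  open Endo A using (_^_; ^-homo)

  lookup-injective : ∀ {xs : List A} → Unique xs → (i j : Fin (length xs)) →
                     List.lookup xs i ≡ List.lookup xs j → i ≡ j
  lookup-injective (_ ∷ _)  zero    zero    _  = refl
  lookup-injective (x∉ ∷ _) zero    (suc j) eq = contradiction eq (ListAll.lookup x∉ (∈-lookup j))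
  lookup-injective (x∉ ∷ _) (suc i) zero    eq = contradiction (sym eq) (ListAll.lookup x∉ (∈-lookup i))
  lookup-injective (_ ∷ u)  (suc i) (suc j) eq = cong suc (lookup-injective u i j eq)

  unique-⊆⇒length≤ : ∀ {xs ys : List A} → Unique xs → xs ⊆ ys → length xs ℕ.≤ length ys
  unique-⊆⇒length≤ {xs} {ys} uniq sub = injective⇒≤ {f = λ i → index (sub (∈-lookup i))}
    λ {i} {j} eq → lookup-injective uniq i j
      (Membership.index-injective (setoid A) (sub (∈-lookup i)) (sub (∈-lookup j)) eq)

  unique-⊆⊇⇒length≡ : ∀ {xs ys : List A} → Unique xs → Unique ys → xs ⊆ ys → ys ⊆ xs →
                      length xs ≡ length ys
  unique-⊆⊇⇒length≡ u v sub sup = ℕ.≤-antisym (unique-⊆⇒length≤ u sub) (unique-⊆⇒length≤ v sup)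

  length-filter-¬ : ∀ {P : Pred A 0ℓ} (P? : Decidable P) xs →
                    length xs ≡ length (filter P? xs) ℕ.+ length (filter (¬? ∘ P?) xs)
  length-filter-¬ P? [] = refl
  length-filter-¬ P? (x ∷ xs) with does (P? x)
  ... | true  = cong suc (length-filter-¬ P? xs)
  ... | false = trans (cong suc (length-filter-¬ P? xs)) (sym (ℕ.+-suc _ _))

  ^-* : ∀ (f : A → A) {x : A} a b → (f ^ b) x ≡ x → (f ^ (a ℕ.* b)) x ≡ x
  ^-* f zero    b eq = refl
  ^-* f (suc a) b eq = trans (cong-app (^-homo f b (a ℕ.* b)) _)
    (trans (cong (f ^ b) (^-* f a b eq)) eq)

  -- Bézout over the naturals gives `1 + n b = m a` or `1 + m a = n b`. In either case one
  -- application of `f` can be completed to a multiple of an exponent that fixes `x`.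
  ^-coprime : ∀ (f : A → A) {x : A} {a b} → Coprime a b →
              (f ^ a) x ≡ x → (f ^ b) x ≡ x → f x ≡ x
  ^-coprime f {x} {a} {b} cop fa fb with Bézout.identity (coprime⇒GCD≡1 cop)
  ... | Bézout.+- m n eq = trans (cong f (sym (^-* f n b fb)))
          (trans (cong (λ k → (f ^ k) x) eq) (^-* f m a fa))
  ... | Bézout.-+ m n eq = trans (cong f (sym (^-* f m a fa)))
          (trans (cong (λ k → (f ^ k) x) eq) (^-* f n b fb))

-- Orbits of an action of prime order

module CyclicAction {A : Set} (_≟_ : DecidableEquality A) {p : ℕ} (prime : Prime (suc p))
                    (σ : A → A) (σ^p : ∀ x → Endo._^_ A σ (suc p) x ≡ x) where

  open Endo A using (_^_; ^-homo)
  open DecMembership _≟_ using (_∈?_)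

  fixed? : Decidable (λ x → σ x ≡ x)
  fixed? x = σ x ≟ x

  Closed : List A → Set
  Closed xs = ∀ {x} → x ∈ xs → σ x ∈ xs

  ^-closed : ∀ {xs} → Closed xs → ∀ n {x} → x ∈ xs → (σ ^ n) x ∈ xs
  ^-closed closed zero    x∈ = x∈
  ^-closed closed (suc n) x∈ = closed (^-closed closed n x∈)

  σ-injective : ∀ {x y} → σ x ≡ σ y → x ≡ y
  σ-injective {x} {y} eq = trans (sym (σ^p′ x)) (trans (cong (σ ^ p) eq) (σ^p′ y))
    where
    σ^p′ : ∀ x → (σ ^ p) (σ x) ≡ x
    σ^p′ x = trans (sym (cong-app (^-homo σ p 1) x))
      (trans (cong (λ k → (σ ^ k) x) (ℕ.+-comm p 1)) (σ^p x))

  ^-injective : ∀ n {x y} → (σ ^ n) x ≡ (σ ^ n) y → x ≡ y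
  ^-injective zero    eq = eq
  ^-injective (suc n) eq = ^-injective n (σ-injective eq)

  private
    -- Cancelling `σ ^ i` from a coincidence leaves a power `suc d`, smaller than the order, that
    -- fixes `x`. As the order is prime, `suc d` is coprime to it, so `σ` itself would fix `x`.
    ^-distinct : ∀ {x} → σ x ≢ x → ∀ i j → i ℕ.< j → j ℕ.< suc p → (σ ^ i) x ≢ (σ ^ j) x
    ^-distinct {x} moved i j i<j j<p eq with d , refl ← ℕ.m≤n⇒∃[o]m+o≡n i<j =
      moved (^-coprime σ (prime⇒coprime prime
        (ℕ.≤-<-trans (s≤s (ℕ.m≤n+m d i)) j<p))
        (σ^p x)
        (sym (^-injective i (trans eq (trans (cong (λ k → (σ ^ k) x) (sym (ℕ.+-suc i d)))
           (cong-app (^-homo σ i (suc d)) x))))))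

  power : A → Fin (suc p) → A
  power x i = (σ ^ toℕ i) x

  orbit : A → List A
  orbit x = List.tabulate (power x)

  orbit-unique : ∀ {x} → σ x ≢ x → Unique (orbit x)
  orbit-unique {x} moved = Unique.tabulate⁺ {f = power x} inj
    where
    inj : ∀ {i j : Fin (suc p)} → (σ ^ toℕ i) x ≡ (σ ^ toℕ j) x → i ≡ j
    inj {i} {j} eq with ℕ.<-cmp (toℕ i) (toℕ j)
    ... | tri< i<j _ _ = contradiction eq (^-distinct moved _ _ i<j (toℕ<n j))
    ... | tri≈ _ i≡j _ = toℕ-injective i≡j
    ... | tri> _ _ j<i = contradiction (sym eq) (^-distinct moved _ _ j<i (toℕ<n i))

  -- Ensures that removing an orbit leaves a closed list. If `σ y` is `x` itself, then `y` is the
  -- last entry `σ ^ p` of the orbit; otherwise `y` is the preceding entry.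
  orbit-reflects : ∀ {x y} → σ y ∈ orbit x → y ∈ orbit x
  orbit-reflects {x} {y} σy∈ with ∈-tabulate⁻ {f = power x} σy∈
  ... | zero  , eq = subst (_∈ orbit x)
          (σ-injective (trans (σ^p x) (sym eq)))
          (subst (λ k → (σ ^ k) x ∈ orbit x) (toℕ-fromℕ p) (∈-tabulate⁺ {f = power x} (fromℕ p)))
  ... | suc i , eq = subst (_∈ orbit x)
          (sym (σ-injective eq))
          (subst (λ k → (σ ^ k) x ∈ orbit x) (toℕ-inject₁ i) (∈-tabulate⁺ {f = power x} (inject₁ i)))

  -- Removes the orbit of the head, exactly `suc p` entries, and recurses. The bound `n` drives the
  -- recursion because the filtered remainder is not a structural sublist.
  moved⇒∣length : ∀ n (xs : List A) → length xs ℕ.≤ n → Unique xs → Closed xs →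
                  (∀ {x} → x ∈ xs → σ x ≢ x) → suc p ℕ.∣ length xs
  moved⇒∣length n [] _ _ _ _ = suc p ℕ.∣0
  moved⇒∣length (suc n) xs@(x ∷ xs′) (s≤s len) uniq closed moved =
    subst (suc p ℕ.∣_) (sym split) (ℕ.∣m∣n⇒∣m+n ℕ.∣-refl
      (moved⇒∣length n rest shorter (Unique.filter⁺ (¬? ∘ (_∈? orbit x)) uniq) rest-closed
        (moved ∘ proj₁ ∘ ∈-filter⁻ (¬? ∘ (_∈? orbit x)) {xs = xs})))
    where
    rest = filter (¬? ∘ (_∈? orbit x)) xs
    inside = filter (_∈? orbit x) xs
    inside-length : length inside ≡ suc p
    inside-length = trans
      (unique-⊆⊇⇒length≡ (Unique.filter⁺ (_∈? orbit x) uniq) (orbit-unique (moved (here refl)))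
        (proj₂ ∘ ∈-filter⁻ (_∈? orbit x) {xs = xs})
        λ y∈ → ∈-filter⁺ (_∈? orbit x)
          (let i , eq = ∈-tabulate⁻ {f = power x} y∈ in
           subst (_∈ xs) (sym eq) (^-closed closed (toℕ i) (here refl))) y∈)
      (length-tabulate (power x))
    split : length xs ≡ suc p ℕ.+ length rest
    split = trans (length-filter-¬ (_∈? orbit x) xs) (cong (ℕ._+ length rest) inside-length)
    shorter : length rest ℕ.≤ n
    shorter = ℕ.≤-trans (subst (length rest ℕ.≤_) (sym (ℕ.suc-injective split)) (ℕ.m≤n+m _ p)) len
    rest-closed : Closed rest
    rest-closed y∈ = let y∈xs , y∉ = ∈-filter⁻ (¬? ∘ (_∈? orbit x)) {xs = xs} y∈ in
      ∈-filter⁺ (¬? ∘ (_∈? orbit x)) (closed y∈xs) (y∉ ∘ orbit-reflects)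

  ∣length-moved : ∀ {xs : List A} → Unique xs → Closed xs →
                  suc p ℕ.∣ length (filter (¬? ∘ fixed?) xs)
  ∣length-moved {xs} uniq closed = moved⇒∣length _ _ ℕ.≤-refl (Unique.filter⁺ (¬? ∘ fixed?) uniq)
    (λ y∈ → let y∈xs , moved = ∈-filter⁻ (¬? ∘ fixed?) {xs = xs} y∈ in
      ∈-filter⁺ (¬? ∘ fixed?) (closed y∈xs) (moved ∘ σ-injective))
    (λ {x} y∈ → proj₂ (∈-filter⁻ (¬? ∘ fixed?) {xs = xs} y∈))

-- Membership and uniqueness in the enumerated boxes

module _ {A : Set} where

  count≡length-filter : ∀ (f : A → Bool) xs → count f xs ≡ length (filter (λ x → f x Bool.≟ true) xs)
  count≡length-filter f []       = refl
  count≡length-filter f (x ∷ xs) with f x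
  ... | true  = cong suc (count≡length-filter f xs)
  ... | false = count≡length-filter f xs

  -- Brings the enumerations inside `thetaCoeff` into the shape of a cartesian product, for which
  -- uniqueness and membership are known.
  words≡cartesian : ∀ {n} (xs : List A) (vs : List (Vec A n)) →
    concatMap (λ x → List.map (x ∷_) vs) xs ≡ cartesianProductWith _∷_ xs vs
  words≡cartesian []       vs = refl
  words≡cartesian (x ∷ xs) vs = cong (List.map (x ∷_) vs List.++_) (words≡cartesian xs vs)

  tuples-unique : ∀ {xs : List A} → Unique xs → ∀ n → Unique (tuples n xs)
  tuples-unique u zero = [] ∷ []
  tuples-unique {xs} u (suc n) = subst Unique (sym (words≡cartesian xs (tuples n xs)))
    (Unique.cartesianProductWith⁺ _∷_ Vecₚ.∷-injective u (tuples-unique u n))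

  ∈-tuples⁺ : ∀ {xs : List A} {n} {v : Vec A n} → All (_∈ xs) v → v ∈ tuples n xs
  ∈-tuples⁺ [] = here refl
  ∈-tuples⁺ {xs} {suc n} {x ∷ v} (x∈ ∷ v∈) = subst (x ∷ v ∈_) (sym (words≡cartesian xs (tuples n xs)))
    (∈-cartesianProductWith⁺ _∷_ x∈ (∈-tuples⁺ v∈))

  ∈-tuples⁻ : ∀ {xs : List A} {n} {v : Vec A n} → v ∈ tuples n xs → All (_∈ xs) v
  ∈-tuples⁻ {n = zero}  {[]} _  = []
  ∈-tuples⁻ {xs} {suc n}     v∈ with ∈-cartesianProductWith⁻ _∷_ xs (tuples n xs)
                                      (subst (_ ∈_) (words≡cartesian xs (tuples n xs)) v∈)
  ... | _ , _ , x∈ , w∈ , refl = x∈ ∷ ∈-tuples⁻ w∈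

box≡tuples : ∀ d B → box d B ≡ tuples d (range B)
box≡tuples zero    B = refl
box≡tuples (suc d) B = cong (λ vs → concatMap (λ x → List.map (x ∷_) vs) (range B)) (box≡tuples d B)

range-unique : ∀ B → Unique (range B)
range-unique B = Unique.++⁺
  (Unique.map⁺ ℤ.+-injective (Unique.upTo⁺ (suc B)))
  (Unique.map⁺ (λ { refl → refl }) (Unique.upTo⁺ B))
  λ (x∈ , y∈) → let k , _ , eq = ∈-map⁻ +_ x∈
                    l , _ , eq′ = ∈-map⁻ (λ k → - (+ suc k)) y∈ in
    contradiction (trans (sym eq) eq′) λ ()

∈-range⁺ : ∀ {B} x → ∣ x ∣ ℕ.≤ B → x ∈ range B
∈-range⁺ {B} (+ n)    n≤B = ∈-++⁺ˡ (∈-map⁺ +_ (∈-upTo⁺ (s≤s n≤B)))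
∈-range⁺ {B} -[1+ n ] n<B = ∈-++⁺ʳ (List.map +_ (List.upTo (suc B))) (∈-map⁺ (λ k → - (+ suc k)) (∈-upTo⁺ n<B))

-- Rotation of the first 23 coordinates

ins : ∀ {A : Set} m {k} → A → Vec A (m ℕ.+ k) → Vec A (suc m ℕ.+ k)
ins zero    x ys       = x ∷ ys
ins (suc m) x (y ∷ ys) = y ∷ ins m x ys

-- A cyclic left shift by one place: the head is reinserted behind the next 22 entries, and the last
-- `k` entries stay put.
rot : ∀ {A : Set} {k} → Vec A (23 ℕ.+ k) → Vec A (23 ℕ.+ k)
rot (x ∷ xs) = ins 22 x xs

module _ {A : Set} where

  ins-All : ∀ {P : A → Set} m {k x} {ys : Vec A (m ℕ.+ k)} → P x → All P ys → All P (ins m x ys)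
  ins-All zero    px pys        = px ∷ pys
  ins-All (suc m) px (py ∷ pys) = py ∷ ins-All m px pys

  -- Comparing heads shows that the first entry of `ys` is `z`; what remains is the same equation
  -- for a smaller `m`, so `z` propagates through all `m` places.
  ins-fixed : ∀ m {k x z} (ys : Vec A (m ℕ.+ k)) → ins m x ys ≡ z ∷ ys →
              ∃ λ rest → ys ≡ replicate m z ++ rest
  ins-fixed zero    ys       eq = ys , refl
  ins-fixed (suc m) (y ∷ ys) eq with refl ← Vecₚ.∷-injectiveˡ eq
    with rest , refl ← ins-fixed m ys (Vecₚ.∷-injectiveʳ eq) = rest , refl

  rot-fixed : ∀ {k} (v : Vec A (23 ℕ.+ k)) → rot v ≡ v → ∃ λ a → ∃ λ rest → v ≡ replicate 23 a ++ rest
  rot-fixed (x ∷ xs) eq with rest , refl ← ins-fixed 22 xs eq = x , rest , refl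

  rot-All : ∀ {P : A → Set} {k} {v : Vec A (23 ℕ.+ k)} → All P v → All P (rot v)
  rot-All (px ∷ pxs) = ins-All 22 px pxs

  map-ins : ∀ {B : Set} (f : A → B) m {k} x (ys : Vec A (m ℕ.+ k)) →
            Vec.map f (ins m x ys) ≡ ins m (f x) (Vec.map f ys)
  map-ins f zero    x ys       = refl
  map-ins f (suc m) x (y ∷ ys) = cong (f y ∷_) (map-ins f m x ys)

  map-rot : ∀ {B : Set} (f : A → B) {k} (v : Vec A (23 ℕ.+ k)) → Vec.map f (rot v) ≡ rot (Vec.map f v)
  map-rot f (x ∷ xs) = map-ins f 22 x xs

sumV-ins : ∀ m {k} x (ys : Vec ℤ (m ℕ.+ k)) → sumV (ins m x ys) ≡ x + sumV ys
sumV-ins zero    x ys       = refl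
sumV-ins (suc m) x (y ∷ ys) = trans (cong (λ s → y + s) (sumV-ins m x ys)) (swap y x (sumV ys))
  where
  swap : ∀ a b c → a + (b + c) ≡ b + (a + c)
  swap = solve-∀

sumV-rot : ∀ {k} (v : Vec ℤ (23 ℕ.+ k)) → sumV (rot v) ≡ sumV v
sumV-rot (x ∷ xs) = sumV-ins 22 x xs

dot-ins : ∀ m {k} x y (xs ys : Vec ℤ (m ℕ.+ k)) → dot (ins m x xs) (ins m y ys) ≡ x * y + dot xs ys
dot-ins zero    x y xs ys = refl
dot-ins (suc m) x y (x′ ∷ xs) (y′ ∷ ys) =
  trans (cong (λ s → x′ * y′ + s) (dot-ins m x y xs ys)) (swap (x′ * y′) (x * y) (dot xs ys))
  where
  swap : ∀ a b c → a + (b + c) ≡ b + (a + c)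
  swap = solve-∀

dot-rot : ∀ {k} (v w : Vec ℤ (23 ℕ.+ k)) → dot (rot v) (rot w) ≡ dot v w
dot-rot (x ∷ xs) (y ∷ ys) = dot-ins 22 x y xs ys

rot^23 : ∀ {A : Set} {k} (v : Vec A (23 ℕ.+ k)) → Endo._^_ (Vec A (23 ℕ.+ k)) rot 23 v ≡ v
rot^23 (_ ∷ _ ∷ _ ∷ _ ∷ _ ∷ _ ∷ _ ∷ _ ∷ _ ∷ _ ∷ _ ∷ _ ∷ _ ∷ _ ∷ _ ∷ _ ∷ _ ∷ _ ∷ _ ∷ _ ∷ _ ∷ _ ∷ _ ∷ _) = refl

map-^ : ∀ {A : Set} (f : A → A) p {n} (v : Vec A n) →
        Endo._^_ (Vec A n) (Vec.map f) p v ≡ Vec.map (Endo._^_ A f p) v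
map-^ f zero    v = sym (Vecₚ.map-id v)
map-^ f (suc p) v = trans (cong (Vec.map f) (map-^ f p v)) (sym (Vecₚ.map-∘ f _ v))

∈-box⁺ : ∀ d B {v} → All (_∈ range B) v → v ∈ box d B
∈-box⁺ d B v∈ = subst (_ ∈_) (sym (box≡tuples d B)) (∈-tuples⁺ v∈)

∈-box⁻ : ∀ d B {v} → v ∈ box d B → All (_∈ range B) v
∈-box⁻ d B v∈ = ∈-tuples⁻ (subst (_ ∈_) (box≡tuples d B) v∈)

rot-box : ∀ k B {v} → v ∈ box (23 ℕ.+ k) B → rot v ∈ box (23 ℕ.+ k) B
rot-box k B v∈ = ∈-box⁺ (23 ℕ.+ k) B (rot-All (∈-box⁻ (23 ℕ.+ k) B v∈))

-- The solutions counted by a Fourier coefficient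

∧-true⁻ : ∀ {a b} → a ∧ b ≡ true → a ≡ true × b ≡ true
∧-true⁻ {true} eq = refl , eq

⌊⌋-true⁻ : ∀ {P : Set} (P? : Dec P) → ⌊ P? ⌋ ≡ true → P
⌊⌋-true⁻ (yes p) _ = p

⌊⌋-true⁺ : ∀ {P : Set} (P? : Dec P) → P → ⌊ P? ⌋ ≡ true
⌊⌋-true⁺ (yes _)  _ = refl
⌊⌋-true⁺ (no ¬p) p = contradiction p ¬p

allF⁺ : ∀ {n} (f : Fin n → Bool) → (∀ i → f i ≡ true) → allF f ≡ true
allF⁺ {zero}  f all = refl
allF⁺ {suc n} f all = cong₂ _∧_ (all zero) (allF⁺ (f ∘ suc) (all ∘ suc))

allF⁻ : ∀ {n} (f : Fin n → Bool) → allF f ≡ true → ∀ i → f i ≡ true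
allF⁻ f eq zero    = proj₁ (∧-true⁻ eq)
allF⁻ f eq (suc i) = allF⁻ (f ∘ suc) (proj₂ (∧-true⁻ eq)) i

Solution : (L : LatticeModel) → ∀ {n} → HalfIntegral n → Vec (Vec ℤ (dim L)) n → Set
Solution L T vs = (∀ i → mem L (lookup vs i) ≡ true)
                × (∀ i j → dot (lookup vs i) (lookup vs j) ≡ + scale L * twice T i j)

module _ (L : LatticeModel) {n} (T : HalfIntegral n) where

  -- Repeats the test inside `thetaCoeff` verbatim, so that `thetaCoeff L T` unfolds to
  -- `count solves candidates`.
  solves : Vec (Vec ℤ (dim L)) n → Bool
  solves vs = allF (λ i → mem L (lookup vs i))
            ∧ allF (λ i → allF (λ j → dot (lookup vs i) (lookup vs j) ==ℤ (+ scale L * twice T i j)))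

  solves⁻ : ∀ vs → solves vs ≡ true → Solution L T vs
  solves⁻ vs eq = let member , gram = ∧-true⁻ eq in
    allF⁻ _ member , λ i j → ⌊⌋-true⁻ (_ ℤ.≟ _) (allF⁻ _ (allF⁻ _ gram i) j)

  solves⁺ : ∀ vs → Solution L T vs → solves vs ≡ true
  solves⁺ vs (member , gram) = cong₂ _∧_ (allF⁺ _ member)
    (allF⁺ _ λ i → allF⁺ _ λ j → ⌊⌋-true⁺ (_ ℤ.≟ _) (gram i j))

  candidates : List (Vec (Vec ℤ (dim L)) n)
  candidates = tuples n (box (dim L) (scale L ℕ.* trace2 T))

  solutions : List (Vec (Vec ℤ (dim L)) n)
  solutions = filter (λ vs → solves vs Bool.≟ true) candidates

  thetaCoeff≡length : thetaCoeff L T ≡ length solutions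
  thetaCoeff≡length = count≡length-filter solves candidates

  box-unique : ∀ d B → Unique (box d B)
  box-unique d B = subst Unique (sym (box≡tuples d B)) (tuples-unique (range-unique B) d)

  solutions-unique : Unique solutions
  solutions-unique = Unique.filter⁺ (λ vs → solves vs Bool.≟ true)
    (tuples-unique (box-unique (dim L) _) n)

  ∈-solutions⁻ : ∀ {vs} → vs ∈ solutions → vs ∈ candidates × Solution L T vs
  ∈-solutions⁻ {vs} vs∈ = let vs∈′ , eq = ∈-filter⁻ (λ vs → solves vs Bool.≟ true) {xs = candidates} vs∈ in
    vs∈′ , solves⁻ vs eq

  ∈-solutions⁺ : ∀ {vs} → vs ∈ candidates → Solution L T vs → vs ∈ solutions
  ∈-solutions⁺ {vs} vs∈ sol = ∈-filter⁺ (λ vs → solves vs Bool.≟ true) vs∈ (solves⁺ vs sol)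

prime-23 : Prime 23
prime-23 = from-yes (prime? 23)

-- Binary forms of determinant 23

-- The bilinear form with Gram matrix (a 1; 1 c), evaluated at the vectors (x, y) and (x′, y′).
form : ℕ → ℕ → ℤ → ℤ → ℤ → ℤ → ℤ
form a c x y x′ y′ = + a * (x * x′) + (x * y′ + y * x′) + + c * (y * y′)

-- Coordinates of (1, 0), (0, 1) and (0, 0); the zero vector pads the binary form to degree 3.
basisX basisY : Fin 3 → ℤ
basisX = lookup (+ 1 ∷ + 0 ∷ + 0 ∷ [])
basisY = lookup (+ 0 ∷ + 1 ∷ + 0 ∷ [])

form-sym : ∀ a c x y x′ y′ → form a c x y x′ y′ ≡ form a c x′ y′ x y
form-sym a c = lemma (+ a) (+ c)
  where
  lemma : ∀ a c x y x′ y′ → a * (x * x′) + (x * y′ + y * x′) + c * (y * y′)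
                          ≡ a * (x′ * x) + (x′ * y + y′ * x) + c * (y′ * y)
  lemma = solve-∀

-- `a*c≡24` makes the determinant 23. `a*a<23` leaves ±(1, 0) as the only vectors of norm `a`, and
-- `2≤a` bounds the first coordinate of the image of (0, 1).
record BinaryForm : Set where
  field
    a c      : ℕ
    a*c≡24   : a ℕ.* c ≡ 24
    2≤a      : 2 ℕ.≤ a
    a*a<23   : a ℕ.* a ℕ.< 23
    even     : ∀ i → form a c (basisX i) (basisY i) (basisX i) (basisY i) %ℕ 2 ≡ 0

  form-basis : HalfIntegral 3
  form-basis = mkHI (λ i j → form a c (basisX i) (basisY i) (basisX j) (basisY j))
    (λ i j → form-sym a c (basisX i) (basisY i) (basisX j) (basisY j)) even

module _ where
  open +-*-Solver

  -- Σp, detp and formp evaluate definitionally to Σℤ, det and form, so that the ring solver applies to these.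
  Σp : ∀ {m n} → (Fin n → Polynomial m) → Polynomial m
  Σp {n = zero}  f = con (+ 0)
  Σp {n = suc n} f = f zero :+ Σp (f ∘ suc)

  detp : ∀ {m} n → (Fin n → Fin n → Polynomial m) → Polynomial m
  detp zero    M = con (+ 1)
  detp (suc n) M = Σp λ j → con (sgn (toℕ j)) :* (M zero j :* detp n (λ i k → M (suc i) (punchIn j k)))

  formp : ∀ {m} (a c x y x′ y′ : Polynomial m) → Polynomial m
  formp a c x y x′ y′ = a :* (x :* x′) :+ (x :* y′ :+ y :* x′) :+ c :* (y :* y′)

  -- The matrix is the Gram matrix of two vectors, that is, the base form transformed by their
  -- coordinate matrix; its determinant is therefore the base determinant times the square of
  -- `minor`.
  det-form₂ : ∀ a c (x y : Fin 2 → ℤ) → let minor = x zero * y (suc zero) - x (suc zero) * y zero in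
    det 2 (λ i j → form a c (x i) (y i) (x j) (y j))
    ≡ (+ a * + c - + 1) * (minor * minor)
  det-form₂ a c x y = solve 6 (λ a c x₀ x₁ y₀ y₁ →
      detp 2 (λ i j → formp a c (lookup (x₀ ∷ x₁ ∷ []) i) (lookup (y₀ ∷ y₁ ∷ []) i)
                                (lookup (x₀ ∷ x₁ ∷ []) j) (lookup (y₀ ∷ y₁ ∷ []) j))
      := (a :* c :- con (+ 1)) :* ((x₀ :* y₁ :- x₁ :* y₀) :* (x₀ :* y₁ :- x₁ :* y₀)))
    refl (+ a) (+ c) (x zero) (x (suc zero)) (y zero) (y (suc zero))

  -- A sum of two matrices of rank at most one has rank at most two.
  det-rank2 : ∀ (p q r s : Fin 3 → ℤ) → det 3 (λ i j → p i * q j + r i * s j) ≡ + 0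
  det-rank2 p q r s = solve 12 (λ p₀ p₁ p₂ q₀ q₁ q₂ r₀ r₁ r₂ s₀ s₁ s₂ →
      detp 3 (λ i j → lookup (p₀ ∷ p₁ ∷ p₂ ∷ []) i :* lookup (q₀ ∷ q₁ ∷ q₂ ∷ []) j
                   :+ lookup (r₀ ∷ r₁ ∷ r₂ ∷ []) i :* lookup (s₀ ∷ s₁ ∷ s₂ ∷ []) j)
      := con (+ 0))
    refl (p zero) (p (suc zero)) (p (suc (suc zero))) (q zero) (q (suc zero)) (q (suc (suc zero)))
         (r zero) (r (suc zero)) (r (suc (suc zero))) (s zero) (s (suc zero)) (s (suc (suc zero)))

Σ-cong : ∀ {n} {f g : Fin n → ℤ} → (∀ i → f i ≡ g i) → Σℤ f ≡ Σℤ g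
Σ-cong {zero}  eq = refl
Σ-cong {suc n} eq = cong₂ _+_ (eq zero) (Σ-cong (eq ∘ suc))

det-cong : ∀ n {M N : Mat n} → (∀ i j → M i j ≡ N i j) → det n M ≡ det n N
det-cong zero    eq = refl
det-cong (suc n) eq = Σ-cong λ j → cong (sgn (toℕ j) *_)
  (cong₂ _*_ (eq zero j) (det-cong n λ i k → eq (suc i) (punchIn j k)))

-- Exhibits a Gram matrix as a sum of two rank-one matrices, the shape `det-rank2` expects.
form-split : ∀ a c x y x′ y′ → form a c x y x′ y′ ≡ (+ a * x + y) * x′ + (x + + c * y) * y′
form-split a c = lemma (+ a) (+ c)
  where
  lemma : ∀ a c x y x′ y′ → a * (x * x′) + (x * y′ + y * x′) + c * (y * y′)
                          ≡ (a * x + y) * x′ + (x + c * y) * y′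
  lemma = solve-∀

complete-square : ∀ a c x y → + a * form a c x y x y ≡ (+ a * x + y) * (+ a * x + y) + (+ a * + c - + 1) * (y * y)
complete-square a c = lemma (+ a) (+ c)
  where
  lemma : ∀ a c x y → a * (a * (x * x) + (x * y + y * x) + c * (y * y))
                    ≡ (a * x + y) * (a * x + y) + (a * c - + 1) * (y * y)
  lemma = solve-∀

¬3-minor : ∀ a c (M : Mat 3) (x y : Fin 3 → ℤ) → (∀ i j → M i j ≡ form a c (x i) (y i) (x j) (y j)) →
           ¬ NonzeroMinor 3 M 3
¬3-minor a c M x y gram (f , g , nonzero) = nonzero (trans
  (det-cong 3 λ i j → trans (gram (f i) (g j)) (form-split a c (x (f i)) (y (f i)) (x (g j)) (y (g j))))
  (det-rank2 (λ i → + a * x (f i) + y (f i)) (x ∘ g) (λ i → x (f i) + + c * y (f i)) (y ∘ g)))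

square≡ : ∀ x → x * x ≡ + (∣ x ∣ ℕ.* ∣ x ∣)
square≡ (+ n)    = sym (ℤ.pos-* n n)
square≡ -[1+ n ] = refl

square≥0 : ∀ x → + 0 ≤ x * x
square≥0 x = subst (+ 0 ≤_) (sym (square≡ x)) (ℤ.+≤+ z≤n)

square+23square : ∀ u y {n} → u * u + + 23 * (y * y) ≡ + n → ∣ u ∣ ℕ.* ∣ u ∣ ℕ.+ 23 ℕ.* (∣ y ∣ ℕ.* ∣ y ∣) ≡ n
square+23square u y {n} eq = ℤ.+-injective (trans (sym (trans
  (cong₂ (λ s t → s + + 23 * t) (square≡ u) (square≡ y))
  (cong (λ t → + (∣ u ∣ ℕ.* ∣ u ∣) + t) (sym (ℤ.pos-* 23 (∣ y ∣ ℕ.* ∣ y ∣)))))) eq)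

-- A nonzero `y` would already contribute at least 23 to the sum.
small⇒≡0 : ∀ u y {n} → n ℕ.< 23 → u * u + + 23 * (y * y) ≡ + n → y ≡ + 0
small⇒≡0 u y {n} n<23 eq with ∣ y ∣ in abs | square+23square u y eq
... | zero  | _   = ℤ.∣i∣≡0⇒i≡0 abs
... | suc m | eq′ = contradiction n<23 (ℕ.≤⇒≯ (ℕ.≤-trans
        (ℕ.≤-trans (ℕ.m≤m*n 23 (suc m ℕ.* suc m)) (ℕ.m≤n+m _ (∣ u ∣ ℕ.* ∣ u ∣)))
        (ℕ.≤-reflexive eq′)))

±1 : List ℤ
±1 = + 1 ∷ -1ℤ ∷ []

square≡1⇒∈±1 : ∀ x → x * x ≡ + 1 → x ∈ ±1
square≡1⇒∈±1 x eq = go x (ℕ.m*n≡1⇒m≡1 ∣ x ∣ ∣ x ∣ (ℤ.+-injective (trans (sym (square≡ x)) eq)))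
  where
  go : ∀ x → ∣ x ∣ ≡ 1 → x ∈ ±1
  go (+ 1)    refl = here refl
  go -[1+ 0 ] refl = there (here refl)

∣x∣≤1⇒∈ : ∀ x → ∣ x ∣ ℕ.≤ 1 → x ∈ + 0 ∷ ±1
∣x∣≤1⇒∈ (+ 0)    _ = here refl
∣x∣≤1⇒∈ (+ 1)    _ = there (here refl)
∣x∣≤1⇒∈ -[1+ 0 ] _ = there (there (here refl))
∣x∣≤1⇒∈ (+ suc (suc _)) (s≤s ())
∣x∣≤1⇒∈ -[1+ suc _ ] (s≤s ())

∈±1⇒∣∣≡1 : ∀ {x} → x ∈ ±1 → ∣ x ∣ ≡ 1
∈±1⇒∣∣≡1 (here refl)         = refl
∈±1⇒∣∣≡1 (there (here refl)) = refl

module _ (F : BinaryForm) where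
  open BinaryForm F

  +a*+c≡24 : + a * + c ≡ + 24
  +a*+c≡24 = trans (sym (ℤ.pos-* a c)) (cong +_ a*c≡24)

  private instance
    a≢0 : ℕ.NonZero a
    a≢0 = ℕ.>-nonZero (ℕ.≤-trans (s≤s z≤n) 2≤a)

  a*form≡ : ∀ x y → + a * form a c x y x y ≡ (+ a * x + y) * (+ a * x + y) + + 23 * (y * y)
  a*form≡ x y = trans (complete-square a c x y)
    (cong (λ k → (+ a * x + y) * (+ a * x + y) + (k - + 1) * (y * y)) +a*+c≡24)

  form≥0 : ∀ x y → + 0 ≤ form a c x y x y
  form≥0 x y = ℤ.*-cancelˡ-≤-pos (+ 0) (form a c x y x y) (+ a) {{ℤ.positive (ℤ.+<+ (ℕ.>-nonZero⁻¹ a))}}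
    (subst₂ _≤_ (sym (ℤ.*-zeroʳ (+ a))) (sym (a*form≡ x y))
      (ℤ.+-mono-≤ (square≥0 (+ a * x + y)) (ℤ.*-monoˡ-≤-nonNeg (+ 23) (square≥0 y))))

  form-basis-PSD : PSD form-basis
  form-basis-PSD z = subst (+ 0 ≤_) (lemma (+ a) (+ c) (z zero) (z (suc zero)) (z (suc (suc zero))))
                           (form≥0 (z zero) (z (suc zero)))
    where
    open +-*-Solver
    lemma = solve 5 (λ a c z₀ z₁ z₂ → let z = lookup (z₀ ∷ z₁ ∷ z₂ ∷ [])
                                          x = lookup (con (+ 1) ∷ con (+ 0) ∷ con (+ 0) ∷ [])
                                          y = lookup (con (+ 0) ∷ con (+ 1) ∷ con (+ 0) ∷ []) in
      formp a c z₀ z₁ z₀ z₁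
      := Σp λ i → Σp λ j → z i :* (formp a c (x i) (y i) (x j) (y j) :* z j)) refl

  form-basis-rank : rankT form-basis 2
  -- `inject₁` selects the first two rows and columns, whose minor is `a c - 1 = 23`. The only
  -- larger order is 3.
  form-basis-rank = (inject₁ , inject₁ , λ eq → nonzero (trans (sym det≡23) eq)) ,
    λ { 3 (s≤s (s≤s (s≤s z≤n))) (s≤s (s≤s (s≤s z≤n))) → ¬3-minor a c (twice form-basis) basisX basisY λ i j → refl }
    where
    det≡23 : det 2 (λ i j → twice form-basis (inject₁ i) (inject₁ j)) ≡ + 23
    det≡23 = trans (det-form₂ a c (basisX ∘ inject₁) (basisY ∘ inject₁))
                   (cong (λ k → (k - + 1) * + 1) +a*+c≡24)
    nonzero : + 23 ≢ + 0
    nonzero ()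

  -- Completing the square, a·form(x,y) = (ax+y)² + 23y²; equality of norms forces y = 0 for the first
  -- and third vectors and y² = 1 for the second.
  automorphs : ∀ (x y : Fin 3 → ℤ) →
    (∀ i j → form a c (x i) (y i) (x j) (y j) ≡ twice form-basis i j) →
    (x zero ∈ ±1 × y zero ≡ + 0)
    × (x (suc zero) ∈ + 0 ∷ ±1 × y (suc zero) ∈ ±1)
    × (x (suc (suc zero)) ≡ + 0 × y (suc (suc zero)) ≡ + 0)
  automorphs x y gram = (x₀∈ , y₀≡0) , (x₁∈ , y₁∈) , (x₂≡0 , y₂≡0)
    where
    i₀ i₁ i₂ : Fin 3
    i₀ = zero
    i₁ = suc zero
    i₂ = suc (suc zero)

    norm : ∀ i → (+ a * x i + y i) * (+ a * x i + y i) + + 23 * (y i * y i) ≡ + a * twice form-basis i i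
    norm i = trans (sym (a*form≡ (x i) (y i))) (cong (+ a *_) (gram i i))

    T₀₀ : + a * twice form-basis i₀ i₀ ≡ + (a ℕ.* a)
    T₀₀ = trans (lemma (+ a) (+ c)) (sym (ℤ.pos-* a a))
      where
      lemma : ∀ a c → a * (a * (+ 1 * + 1) + (+ 1 * + 0 + + 0 * + 1) + c * (+ 0 * + 0)) ≡ a * a
      lemma = solve-∀

    T₁₁ : + a * twice form-basis i₁ i₁ ≡ + 24
    T₁₁ = trans (lemma (+ a) (+ c)) +a*+c≡24
      where
      lemma : ∀ a c → a * (a * (+ 0 * + 0) + (+ 0 * + 1 + + 1 * + 0) + c * (+ 1 * + 1)) ≡ a * c
      lemma = solve-∀

    T₂₂ : + a * twice form-basis i₂ i₂ ≡ + 0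
    T₂₂ = lemma (+ a) (+ c)
      where
      lemma : ∀ a c → a * (a * (+ 0 * + 0) + (+ 0 * + 0 + + 0 * + 0) + c * (+ 0 * + 0)) ≡ + 0
      lemma = solve-∀

    T₀₁ : twice form-basis i₀ i₁ ≡ + 1
    T₀₁ = lemma (+ a) (+ c)
      where
      lemma : ∀ a c → a * (+ 1 * + 0) + (+ 1 * + 1 + + 0 * + 0) + c * (+ 0 * + 1) ≡ + 1
      lemma = solve-∀

    y₀≡0 : y i₀ ≡ + 0
    y₀≡0 = small⇒≡0 (+ a * x i₀ + y i₀) (y i₀) a*a<23 (trans (norm i₀) T₀₀)

    y₂≡0 : y i₂ ≡ + 0
    y₂≡0 = small⇒≡0 (+ a * x i₂ + y i₂) (y i₂) (s≤s z≤n) (trans (norm i₂) T₂₂)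

    on-axis : ∀ i {t} → y i ≡ + 0 → + a * twice form-basis i i ≡ + (a ℕ.* a) * t → x i * x i ≡ t
    on-axis i {t} y≡0 eq = ℤ.*-cancelˡ-≡ (+ (a ℕ.* a)) (x i * x i) t {{aa≢0}} (begin
        + (a ℕ.* a) * (x i * x i)      ≡⟨ cong (_* (x i * x i)) (ℤ.pos-* a a) ⟩
        + a * + a * (x i * x i)        ≡⟨ lemma (+ a) (x i) ⟩
        (+ a * x i + + 0) * (+ a * x i + + 0) + + 23 * (+ 0 * + 0)
          ≡⟨ cong (λ y → (+ a * x i + y) * (+ a * x i + y) + + 23 * (y * y)) y≡0 ⟨
        (+ a * x i + y i) * (+ a * x i + y i) + + 23 * (y i * y i)  ≡⟨ norm i ⟩
        + a * twice form-basis i i  ≡⟨ eq ⟩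
        + (a ℕ.* a) * t ∎)
      where
      open ≡-Reasoning
      aa≢0 : ℤ.NonZero (+ (a ℕ.* a))
      aa≢0 = ℕ.m*n≢0 a a
      lemma : ∀ a x → a * a * (x * x) ≡ (a * x + + 0) * (a * x + + 0) + + 23 * (+ 0 * + 0)
      lemma = solve-∀

    x₀²≡1 : x i₀ * x i₀ ≡ + 1
    x₀²≡1 = on-axis i₀ y₀≡0 (trans T₀₀ (sym (ℤ.*-identityʳ (+ (a ℕ.* a)))))

    x₀∈ : x i₀ ∈ ±1
    x₀∈ = square≡1⇒∈±1 (x i₀) x₀²≡1

    x₂≡0 : x i₂ ≡ + 0
    x₂≡0 = [ id , id ]′ (ℤ.i*j≡0⇒i≡0∨j≡0 (x i₂)
      (on-axis i₂ y₂≡0 (trans T₂₂ (sym (ℤ.*-zeroʳ (+ (a ℕ.* a)))))))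

    -- Since the first vector has second coordinate 0, its product with the second vector is
    -- `x₀ (a x₁ + y₁)`, and this equals 1. Multiplying by `x₀` and using `x₀² = 1` gives the claim.
    ax₁+y₁≡x₀ : + a * x i₁ + y i₁ ≡ x i₀
    ax₁+y₁≡x₀ = begin
      u                      ≡⟨ ℤ.*-identityˡ u ⟨
      + 1 * u                ≡⟨ cong (_* u) x₀²≡1 ⟨
      x i₀ * x i₀ * u        ≡⟨ lemma (+ a) (+ c) (x i₀) (x i₁) (y i₁) ⟩
      x i₀ * form a c (x i₀) (+ 0) (x i₁) (y i₁) ≡⟨ cong (λ y₀ → x i₀ * form a c (x i₀) y₀ (x i₁) (y i₁)) y₀≡0 ⟨
      x i₀ * form a c (x i₀) (y i₀) (x i₁) (y i₁) ≡⟨ cong (x i₀ *_) (trans (gram i₀ i₁) T₀₁) ⟩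
      x i₀ * + 1             ≡⟨ ℤ.*-identityʳ (x i₀) ⟩
      x i₀ ∎
      where
      open ≡-Reasoning
      u = + a * x i₁ + y i₁
      lemma : ∀ a c x₀ x₁ y₁ → x₀ * x₀ * (a * x₁ + y₁)
        ≡ x₀ * (a * (x₀ * x₁) + (x₀ * y₁ + + 0 * x₁) + c * (+ 0 * y₁))
      lemma = solve-∀

    y₁²≡1 : y i₁ * y i₁ ≡ + 1
    y₁²≡1 = ℤ.*-cancelˡ-≡ (+ 23) (y i₁ * y i₁) (+ 1) (+-cancelˡ (+ 1) (+ 23 * (y i₁ * y i₁)) (+ 23) (begin
      + 1 + + 23 * (y i₁ * y i₁)                  ≡⟨ cong (_+ + 23 * (y i₁ * y i₁)) x₀²≡1 ⟨
      x i₀ * x i₀ + + 23 * (y i₁ * y i₁)          ≡⟨ cong (λ u → u * u + + 23 * (y i₁ * y i₁)) ax₁+y₁≡x₀ ⟨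
      (+ a * x i₁ + y i₁) * (+ a * x i₁ + y i₁) + + 23 * (y i₁ * y i₁) ≡⟨ trans (norm i₁) T₁₁ ⟩
      + 24 ∎))
      where open ≡-Reasoning

    y₁∈ : y i₁ ∈ ±1
    y₁∈ = square≡1⇒∈±1 (y i₁) y₁²≡1

    -- `a x₁ = x₀ - y₁` is a difference of two signs, so `2 |x₁| ≤ a |x₁| ≤ 2`.
    x₁∈ : x i₁ ∈ + 0 ∷ ±1
    x₁∈ = ∣x∣≤1⇒∈ (x i₁) (ℕ.*-cancelˡ-≤ 2 (begin
      2 ℕ.* ∣ x i₁ ∣    ≤⟨ ℕ.*-monoˡ-≤ ∣ x i₁ ∣ 2≤a ⟩
      a ℕ.* ∣ x i₁ ∣    ≡⟨ ℤ.abs-* (+ a) (x i₁) ⟨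
      ∣ + a * x i₁ ∣    ≡⟨ cong ∣_∣ (trans (lemma (+ a * x i₁) (y i₁)) (cong (_- y i₁) ax₁+y₁≡x₀)) ⟩
      ∣ x i₀ - y i₁ ∣   ≤⟨ ℤ.∣i-j∣≤∣i∣+∣j∣ (x i₀) (y i₁) ⟩
      ∣ x i₀ ∣ ℕ.+ ∣ y i₁ ∣ ≡⟨ cong₂ ℕ._+_ (∈±1⇒∣∣≡1 x₀∈) (∈±1⇒∣∣≡1 y₁∈) ⟩
      2 ∎))
      where
      open ℕ.≤-Reasoning
      lemma : ∀ u y → u ≡ u + y - y
      lemma = solve-∀

-- An isometry ρ of order 23 of L whose fixed sublattice is the image of ℤ² with a binary quadratic form.
record CyclicIsometry (L : LatticeModel) (F : BinaryForm) : Set where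
  open BinaryForm F
  field
    scale≢0      : ℕ.NonZero (scale L)
    ρ            : Vec ℤ (dim L) → Vec ℤ (dim L)
    ρ^23         : ∀ v → Endo._^_ (Vec ℤ (dim L)) ρ 23 v ≡ v
    ρ-dot        : ∀ v w → dot (ρ v) (ρ w) ≡ dot v w
    ρ-box        : ∀ B {v} → v ∈ box (dim L) B → ρ v ∈ box (dim L) B
    ρ-member     : ∀ v → mem L v ≡ true → mem L (ρ v) ≡ true
    embed        : ℤ → ℤ → Vec ℤ (dim L)
    embed-fixed  : ∀ x y → ρ (embed x y) ≡ embed x y
    embed-dot    : ∀ x y x′ y′ → dot (embed x y) (embed x′ y′) ≡ + scale L * form a c x y x′ y′
    embed-onto   : ∀ v → mem L v ≡ true → ρ v ≡ v → ∃₂ λ x y → v ≡ embed x y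
    basis-member : ∀ i → mem L (embed (basisX i) (basisY i)) ≡ true
    -- Places the basis vectors inside the enumeration box, so that they really occur among the
    -- counted candidates.
    basis-bound  : ∀ i → All (λ t → ∣ t ∣ ℕ.≤ scale L ℕ.* trace2 form-basis) (embed (basisX i) (basisY i))

-- From a cyclic isometry to both congruence statements

module _ {L F} (isometry : CyclicIsometry L F) where
  open CyclicIsometry isometry
  open BinaryForm F

  Gram : ∀ {n} → HalfIntegral n → Set
  Gram {n} T = ∃₂ λ (x y : Fin n → ℤ) → ∀ i j → twice T i j ≡ form a c (x i) (y i) (x j) (y j)

  module Rotations (n : ℕ) = CyclicAction (Vecₚ.≡-dec {n = n} (Vecₚ.≡-dec ℤ._≟_)) prime-23 (Vec.map ρ)
    (λ vs → trans (map-^ ρ 23 vs) (trans (Vecₚ.map-cong ρ^23 vs) (Vecₚ.map-id vs)))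

  module _ {n} (T : HalfIntegral n) where
    open Rotations n

    solutions-closed : Closed (solutions L T)
    solutions-closed {vs} vs∈ = let vs∈′ , member , gram = ∈-solutions⁻ L T vs∈ in
      ∈-solutions⁺ L T
        (∈-tuples⁺ (All.map⁺ (All.map (ρ-box (scale L ℕ.* trace2 T)) (∈-tuples⁻ vs∈′))))
        ( (λ i → subst (λ v → mem L v ≡ true) (sym (Vecₚ.lookup-map i ρ vs)) (ρ-member _ (member i)))
        , λ i j → trans (cong₂ dot (Vecₚ.lookup-map i ρ vs) (Vecₚ.lookup-map j ρ vs))
                    (trans (ρ-dot (lookup vs i) (lookup vs j)) (gram i j)))

    fixedSolutions : List (Vec (Vec ℤ (dim L)) n)
    fixedSolutions = filter fixed? (solutions L T)

    thetaCoeff≡fixed+23* : ∃ λ m → thetaCoeff L T ≡ length fixedSolutions ℕ.+ m × 23 ℕ.∣ m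
    thetaCoeff≡fixed+23* = _ ,
      trans (thetaCoeff≡length L T) (length-filter-¬ fixed? (solutions L T)) ,
      ∣length-moved (solutions-unique L T) solutions-closed

    ∈-fixedSolutions⁻ : ∀ {vs} → vs ∈ fixedSolutions →
      ∃₂ λ (x y : Fin n → ℤ) → (∀ i → lookup vs i ≡ embed (x i) (y i))
                             × (∀ i j → twice T i j ≡ form a c (x i) (y i) (x j) (y j))
    ∈-fixedSolutions⁻ {vs} vs∈ =
      (λ i → proj₁ (onto i)) , (λ i → proj₁ (proj₂ (onto i))) , (λ i → proj₂ (proj₂ (onto i))) ,
      λ i j → ℤ.*-cancelˡ-≡ (+ scale L) _ _ {{scale≢0}} (trans (sym (gram i j))
        (trans (cong₂ dot (proj₂ (proj₂ (onto i))) (proj₂ (proj₂ (onto j)))) (embed-dot _ _ _ _)))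
      where
      vs∈′ = ∈-filter⁻ fixed? {xs = solutions L T} vs∈
      sol = proj₂ (∈-solutions⁻ L T (proj₁ vs∈′))
      gram = proj₂ sol
      onto : ∀ i → ∃₂ λ x y → lookup vs i ≡ embed x y
      onto i = embed-onto (lookup vs i) (proj₁ sol i)
        (trans (sym (Vecₚ.lookup-map i ρ vs)) (cong (λ ws → lookup ws i) (proj₂ vs∈′)))

    -- With no fixed solution, only the moved ones remain, and 23 divides their number. A single
    -- fixed solution already displays `T` as a Gram matrix of vectors of the binary form.
    ∣thetaCoeff-or-Gram : 23 ℕ.∣ thetaCoeff L T ⊎ Gram T
    ∣thetaCoeff-or-Gram = split fixedSolutions (thetaCoeff≡fixed+23* .proj₂ .proj₁) λ vs∈ →
        let x , y , _ , gram = ∈-fixedSolutions⁻ vs∈ in x , y , gram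
      where
      split : ∀ vss → thetaCoeff L T ≡ length vss ℕ.+ proj₁ thetaCoeff≡fixed+23* →
              (∀ {vs} → vs ∈ vss → Gram T) → 23 ℕ.∣ thetaCoeff L T ⊎ Gram T
      split []       θ≡ _    = inj₁ (subst (23 ℕ.∣_) (sym θ≡) (thetaCoeff≡fixed+23* .proj₂ .proj₂))
      split (vs ∷ _) _  gram = inj₂ (gram (here refl))

  thetaOpVanishes : ThetaOpVanishesMod 23 L 2
  thetaOpVanishes T _ = subst (23 ℕ.∣_) (sym (ℤ.abs-* (+ thetaCoeff L T) (det 2 (twice T))))
    ([ (λ 23∣θ → ℕ.∣m⇒∣m*n ∣ det 2 (twice T) ∣ 23∣θ)
     , (λ (x , y , gram) → ℕ.∣n⇒∣m*n (thetaCoeff L T) (23∣det x y gram))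
     ]′ (∣thetaCoeff-or-Gram T))
    where
    23∣det : ∀ x y → (∀ i j → twice T i j ≡ form a c (x i) (y i) (x j) (y j)) → 23 ℕ.∣ ∣ det 2 (twice T) ∣
    23∣det x y gram = let minor = x zero * y (suc zero) - x (suc zero) * y zero
                          minor² = minor * minor in
      ℕ.divides ∣ minor² ∣ (trans
      (cong ∣_∣ (trans (det-cong 2 gram) (trans (det-form₂ a c x y)
        (trans (cong (λ k → (k - + 1) * minor²) (+a*+c≡24 F)) (ℤ.*-comm (+ 23) minor²)))))
      (ℤ.abs-* minor² (+ 23)))

  basisSolution : Vec (Vec ℤ (dim L)) 3
  basisSolution = Vec.tabulate λ i → embed (basisX i) (basisY i)

  basisSolution-fixed : basisSolution ∈ fixedSolutions form-basis
  basisSolution-fixed = ∈-filter⁺ fixed? (∈-solutions⁺ L form-basis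
      (∈-tuples⁺ (All.tabulate⁺ λ i → ∈-box⁺ (dim L) (scale L ℕ.* trace2 form-basis)
        (All.map (∈-range⁺ _) (basis-bound i))))
      ( (λ i → subst (λ v → mem L v ≡ true) (sym (lookup≡ i)) (basis-member i))
      , λ i j → trans (cong₂ dot (lookup≡ i) (lookup≡ j)) (embed-dot _ _ _ _)))
    (cong₂ _∷_ (embed-fixed _ _) (cong₂ _∷_ (embed-fixed _ _) (cong (_∷ []) (embed-fixed _ _))))
    where
    open Rotations 3 using (fixed?)
    lookup≡ : ∀ i → lookup basisSolution i ≡ embed (basisX i) (basisY i)
    lookup≡ = Vecₚ.lookup∘tabulate _

  automorphTuple : ℤ → ℤ × ℤ → Vec (Vec ℤ (dim L)) 3
  automorphTuple x₀ (x₁ , y₁) = embed x₀ (+ 0) ∷ embed x₁ y₁ ∷ embed (+ 0) (+ 0) ∷ []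

  -- A superset with 2 · 3 · 2 = 12 entries. Some of them need not have the right Gram matrix; only
  -- an upper bound below 23 matters.
  automorphTuples : List (Vec (Vec ℤ (dim L)) 3)
  automorphTuples = List.cartesianProductWith automorphTuple ±1 (List.cartesianProduct (+ 0 ∷ ±1) ±1)

  fixed⊆automorphs : ∀ {vs} → vs ∈ fixedSolutions form-basis → vs ∈ automorphTuples
  fixed⊆automorphs {v₀ ∷ v₁ ∷ v₂ ∷ []} vs∈ =
    let x , y , vs≡ , gram = ∈-fixedSolutions⁻ form-basis vs∈
        (x₀∈ , y₀≡0) , (x₁∈ , y₁∈) , (x₂≡0 , y₂≡0) = automorphs F x y (λ i j → sym (gram i j))
    in subst (_∈ automorphTuples)
        (sym (cong₂ _∷_ (trans (vs≡ zero) (cong (embed _) y₀≡0)) (cong₂ _∷_ (vs≡ (suc zero))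
          (cong (_∷ []) (trans (vs≡ (suc (suc zero))) (cong₂ embed x₂≡0 y₂≡0))))))
        (∈-cartesianProductWith⁺ automorphTuple x₀∈ (∈-cartesianProduct⁺ x₁∈ y₁∈))

  23∤fixed : ¬ 23 ℕ.∣ length (fixedSolutions form-basis)
  -- A nonempty list whose length is divisible by 23 has at least 23 entries, against the bound 12.
  23∤fixed 23∣ = ℕ.<⇒≱ {12} {23} (ℕ.≤ᵇ⇒≤ 13 23 _) (ℕ.≤-trans (ℕ.∣⇒≤ {{nonempty}} 23∣)
      (unique-⊆⇒length≤ (Unique.filter⁺ fixed? (solutions-unique L form-basis)) fixed⊆automorphs))
    where
    open Rotations 3 using (fixed?)
    nonempty : ℕ.NonZero (length (fixedSolutions form-basis))
    nonempty = ℕ.>-nonZero (inhabited basisSolution-fixed)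
      where
      inhabited : ∀ {vs} {vss : List (Vec (Vec ℤ (dim L)) 3)} → vs ∈ vss → 0 ℕ.< length vss
      inhabited {vss = _ ∷ _} _ = s≤s z≤n

  singular : SingularModWithMaxRank 23 L 3 2
  singular = s≤s (s≤s (s≤s z≤n)) , vanish , form-basis , form-basis-PSD F , form-basis-rank F ,
    λ 23∣θ → let m , θ≡ , 23∣m = thetaCoeff≡fixed+23* form-basis in
      23∤fixed (ℕ.∣m+n∣m⇒∣n (subst (23 ℕ.∣_) (trans θ≡ (ℕ.+-comm _ m)) 23∣θ) 23∣m)
    where
    -- Here `r` must be 3, so the rank hypothesis supplies a nonzero minor of order 3, which a Gram
    -- matrix of vectors of a binary form cannot have.
    vanish : ∀ (T : HalfIntegral 3) → PSD T → ∀ r → rankT T r → 3 ℕ.≤ r → r ℕ.≤ 3 → 23 ℕ.∣ thetaCoeff L T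
    vanish T _ r rank 3≤r r≤3 with refl ← ℕ.≤-antisym r≤3 3≤r =
      [ id , (λ (x , y , gram) → contradiction (proj₁ rank) (¬3-minor a c (twice T) x y gram)) ]′
        (∣thetaCoeff-or-Gram T)

-- The extended Golay code is invariant under rotation

xorList-assoc : ∀ u v w → xorList (xorList u v) w ≡ xorList u (xorList v w)
xorList-assoc []      v       w       = refl
xorList-assoc (_ ∷ _) []      w       = refl
xorList-assoc (_ ∷ _) (_ ∷ _) []      = refl
xorList-assoc (a ∷ u) (b ∷ v) (c ∷ w) = cong₂ _∷_ (Bool.xor-assoc a b c) (xorList-assoc u v w)

xorList-comm : ∀ u v → xorList u v ≡ xorList v u
xorList-comm []      []      = refl
xorList-comm []      (_ ∷ _) = refl
xorList-comm (_ ∷ _) []      = refl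
xorList-comm (a ∷ u) (b ∷ v) = cong₂ _∷_ (Bool.xor-comm a b) (xorList-comm u v)

xorList-cancel : ∀ g w → length g ≡ length w → xorList g (xorList g w) ≡ w
xorList-cancel []      []      _  = refl
xorList-cancel (a ∷ g) (b ∷ w) eq = cong₂ _∷_
  (trans (sym (Bool.xor-assoc a a b)) (cong (_xor b) (Bool.xor-same a)))
  (xorList-cancel g w (ℕ.suc-injective eq))

length-xorList : ∀ u v {n} → length u ≡ n → length v ≡ n → length (xorList u v) ≡ n
length-xorList u v refl eq = trans (length-zipWith _xor_ u v) (trans (cong (length u ℕ.⊓_) eq) (ℕ.⊓-idem _))

insList : ∀ {A : Set} → ℕ → A → List A → List A
insList (suc m) x (y ∷ ys) = y ∷ insList m x ys
insList _       x ys       = x ∷ ys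

-- List counterpart of `rot`, since codewords are stored as lists.
rotList : ∀ {A : Set} → List A → List A
rotList []       = []
rotList (x ∷ xs) = insList 22 x xs

toList-ins : ∀ {A : Set} m {k} (x : A) (ys : Vec A (m ℕ.+ k)) → toList (ins m x ys) ≡ insList m x (toList ys)
toList-ins zero    x ys       = refl
toList-ins (suc m) x (y ∷ ys) = cong (y ∷_) (toList-ins m x ys)

toList-rot : ∀ {A : Set} {k} (v : Vec A (23 ℕ.+ k)) → toList (rot v) ≡ rotList (toList v)
toList-rot (x ∷ xs) = toList-ins 22 x xs

insList-xor : ∀ m a b u v → length u ≡ length v →
              insList m (a xor b) (xorList u v) ≡ xorList (insList m a u) (insList m b v)
insList-xor zero    a b u       v        eq = refl
insList-xor (suc m) a b []      []       eq = refl
insList-xor (suc m) a b (c ∷ u) (d ∷ v) eq = cong (_ ∷_) (insList-xor m a b u v (ℕ.suc-injective eq))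

rotList-xor : ∀ u v → length u ≡ length v → rotList (xorList u v) ≡ xorList (rotList u) (rotList v)
rotList-xor []      []      eq = refl
rotList-xor (a ∷ u) (b ∷ v) eq = insList-xor 22 a b u v (ℕ.suc-injective eq)

∈-span⁻ : ∀ g gs {w} → w ∈ spanList (g ∷ gs) → ∃ λ v → v ∈ spanList gs × (w ≡ v ⊎ w ≡ xorList g v)
∈-span⁻ g gs w∈ with find (∈-concatMap⁻ (λ v → v ∷ xorList g v ∷ []) {xs = spanList gs} w∈)
... | v , v∈ , here eq         = v , v∈ , inj₁ eq
... | v , v∈ , there (here eq) = v , v∈ , inj₂ eq

∈-span-skip : ∀ g gs {w} → w ∈ spanList gs → w ∈ spanList (g ∷ gs)
∈-span-skip g gs w∈ = ∈-concatMap⁺ _ (Any.map (λ { refl → here refl }) w∈)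

∈-span-add : ∀ g gs {w} → w ∈ spanList gs → xorList g w ∈ spanList (g ∷ gs)
∈-span-add g gs w∈ = ∈-concatMap⁺ _ (Any.map (λ { refl → there (here refl) }) w∈)

Length24 : List (List Bool) → Set
Length24 = ListAll.All λ g → length g ≡ 24

zero∈span : ∀ gs → zero24 ∈ spanList gs
zero∈span []       = here refl
zero∈span (g ∷ gs) = ∈-span-skip g gs (zero∈span gs)

span-length : ∀ gs {w} → Length24 gs → w ∈ spanList gs → length w ≡ 24
span-length []       _          (here refl) = refl
span-length (g ∷ gs) (lg ∷ lgs) w∈ with ∈-span⁻ g gs w∈
... | v , v∈ , inj₁ refl = span-length gs lgs v∈
... | v , v∈ , inj₂ refl = length-xorList g v lg (span-length gs lgs v∈)

-- Induction on the generators: each word either contains `g` or not, and two copies cancel. The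
-- length hypothesis matters because `xorList` truncates to the shorter word.
span-xor : ∀ gs {u v} → Length24 gs → u ∈ spanList gs → v ∈ spanList gs → xorList u v ∈ spanList gs
span-xor [] _ (here refl) (here refl) = here refl
span-xor (g ∷ gs) (lg ∷ lgs) u∈ v∈ with ∈-span⁻ g gs u∈ | ∈-span⁻ g gs v∈
... | u′ , u′∈ , inj₁ refl | v′ , v′∈ , inj₁ refl = ∈-span-skip g gs (span-xor gs lgs u′∈ v′∈)
... | u′ , u′∈ , inj₂ refl | v′ , v′∈ , inj₁ refl =
  subst (_∈ spanList (g ∷ gs)) (sym (xorList-assoc g u′ v′)) (∈-span-add g gs (span-xor gs lgs u′∈ v′∈))
... | u′ , u′∈ , inj₁ refl | v′ , v′∈ , inj₂ refl =
  subst (_∈ spanList (g ∷ gs))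
    (trans (cong (xorList g) (xorList-comm u′ v′))
      (trans (sym (xorList-assoc g v′ u′)) (xorList-comm (xorList g v′) u′)))
    (∈-span-add g gs (span-xor gs lgs u′∈ v′∈))
... | u′ , u′∈ , inj₂ refl | v′ , v′∈ , inj₂ refl =
  subst (_∈ spanList (g ∷ gs)) (sym (begin
    xorList (xorList g u′) (xorList g v′)   ≡⟨ cong (λ w → xorList w (xorList g v′)) (xorList-comm g u′) ⟩
    xorList (xorList u′ g) (xorList g v′)   ≡⟨ xorList-assoc u′ g (xorList g v′) ⟩
    xorList u′ (xorList g (xorList g v′))
      ≡⟨ cong (xorList u′) (xorList-cancel g v′ (trans lg (sym (span-length gs lgs v′∈)))) ⟩
    xorList u′ v′                           ∎))
    (∈-span-skip g gs (span-xor gs lgs u′∈ v′∈))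
  where open ≡-Reasoning

-- Rotation is linear, so checking generators suffices. The target `hs` is kept separate from `gs`,
-- because the induction shrinks the generators but not the code.
span-rot : ∀ gs {hs w} → Length24 gs → Length24 hs → ListAll.All (λ g → rotList g ∈ spanList hs) gs →
           w ∈ spanList gs → rotList w ∈ spanList hs
span-rot []       {hs} _          _   _          (here refl) = zero∈span hs
span-rot (g ∷ gs) {hs} (lg ∷ lgs) lhs (g∈ ∷ gs∈) w∈ with ∈-span⁻ g gs w∈
... | v , v∈ , inj₁ refl = span-rot gs lgs lhs gs∈ v∈
... | v , v∈ , inj₂ refl = subst (_∈ spanList hs)
        (sym (rotList-xor g v (trans lg (sym (span-length gs lgs v∈)))))
        (span-xor hs lhs g∈ (span-rot gs lgs lhs gs∈ v∈))

eqBits⇒≡ : ∀ u v → T (eqBits u v) → u ≡ v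
eqBits⇒≡ []          []          _  = refl
eqBits⇒≡ (true ∷ u)  (true ∷ v)  eq = cong (true ∷_) (eqBits⇒≡ u v eq)
eqBits⇒≡ (false ∷ u) (false ∷ v) eq = cong (false ∷_) (eqBits⇒≡ u v eq)

eqBits-refl : ∀ u → T (eqBits u u)
eqBits-refl []          = _
eqBits-refl (true ∷ u)  = eqBits-refl u
eqBits-refl (false ∷ u) = eqBits-refl u

any-eqBits⁻ : ∀ w ws → any (eqBits w) ws ≡ true → w ∈ ws
any-eqBits⁻ w ws eq = Any.map (λ {v} → eqBits⇒≡ w v) (Any.any⁻ (eqBits w) ws (Equivalence.from Bool.T-≡ eq))

any-eqBits⁺ : ∀ w ws → w ∈ ws → any (eqBits w) ws ≡ true
any-eqBits⁺ w ws w∈ = Equivalence.to Bool.T-≡ (Any.any⁺ (eqBits w) (Any.map (λ { refl → eqBits-refl w }) w∈))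

golayGenerators-length : Length24 golayGenerators
golayGenerators-length = refl ∷ refl ∷ refl ∷ refl ∷ refl ∷ refl ∷ refl ∷ refl ∷ refl ∷ refl ∷ refl ∷ refl ∷ []

-- Each later generator rotates to its predecessor. The first becomes x²²·g(x) modulo x²³ - 1, again
-- a codeword by cyclicity. All twelve memberships are checked by evaluation.
golayGenerators-rot : ListAll.All (λ g → rotList g ∈ spanList golayGenerators) golayGenerators
golayGenerators-rot = ListAll.map (λ {g} → any-eqBits⁻ (rotList g) golayCode)
  (refl ∷ refl ∷ refl ∷ refl ∷ refl ∷ refl ∷ refl ∷ refl ∷ refl ∷ refl ∷ refl ∷ refl ∷ [])

golay-rot : (w : Vec Bool 24) → inGolay (toList w) ≡ true → inGolay (toList (rot w)) ≡ true
golay-rot w w∈ = any-eqBits⁺ (toList (rot w)) golayCode (subst (_∈ golayCode) (sym (toList-rot w))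
  (span-rot golayGenerators golayGenerators-length golayGenerators-length golayGenerators-rot
    (any-eqBits⁻ (toList w) golayCode w∈)))

-- Taking the word w as a variable keeps the type checker from comparing two unfolded membership tests.
golay-constant : ∀ w β β′ → w ≡ replicate 23 β ++ β′ ∷ [] → inGolay (toList w) ≡ true → β ≡ β′
golay-constant _ false false _ _ = refl
golay-constant _ true  true  _ _ = refl
golay-constant _ false true refl ()
golay-constant _ true false refl ()

golay-map-rot : ∀ {A : Set} (f : A → Bool) (v : Vec A 24) →
                inGolay (toList (Vec.map f v)) ≡ true → inGolay (toList (Vec.map f (rot {k = 1} v))) ≡ true
golay-map-rot f v v∈ = trans (cong (λ w → inGolay (toList w)) (map-rot f {1} v)) (golay-rot (Vec.map f v) v∈)

-- Words of weight 1 and 23 are not codewords, so the last bit must agree with the 23 equal ones.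
-- For `ψ` this gives the parity of the last coordinate of a fixed vector.
golay-map-constant : ∀ {A : Set} (f : A → Bool) v a b → v ≡ replicate 23 a ++ b ∷ [] →
                     inGolay (toList (Vec.map f v)) ≡ true → f a ≡ f b
golay-map-constant f v a b v≡ = golay-constant (Vec.map f v) (f a) (f b) (cong (Vec.map f) v≡)

-- The four lattices

-- Up to equivalence over the integers, these are the two even positive binary forms of determinant
-- 23, the doubles of x² + xy + 6y² and 2x² + xy + 3y². `form₂` contains a vector of norm 2. The
-- Leech lattice has none, and no root of D24 has 23 equal coordinates, so `ω` and `α` need `form₄`.
form₂ form₄ : BinaryForm
form₂ = record
  { a = 2 ; c = 12 ; a*c≡24 = refl ; 2≤a = ℕ.≤ᵇ⇒≤ 2 2 _ ; a*a<23 = ℕ.≤ᵇ⇒≤ 5 23 _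
  ; even = λ { zero → refl ; (suc zero) → refl ; (suc (suc zero)) → refl } }

form₄ = record
  { a = 4 ; c = 6 ; a*c≡24 = refl ; 2≤a = ℕ.≤ᵇ⇒≤ 2 4 _ ; a*a<23 = ℕ.≤ᵇ⇒≤ 17 23 _
  ; even = λ { zero → refl ; (suc zero) → refl ; (suc (suc zero)) → refl } }

dot-replicate : ∀ m {k} a b (xs ys : Vec ℤ k) →
                dot (replicate m a ++ xs) (replicate m b ++ ys) ≡ + m * (a * b) + dot xs ys
dot-replicate zero    a b xs ys = sym (ℤ.+-identityˡ (dot xs ys))
dot-replicate (suc m) a b xs ys = trans
  (cong (λ t → a * b + t) (dot-replicate m a b xs ys))
  (lemma (+ m) (a * b) (dot xs ys))
  where
  lemma : ∀ m p d → p + (m * p + d) ≡ (+ 1 + m) * p + d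
  lemma = solve-∀

sumV-replicate : ∀ m {k} a (xs : Vec ℤ k) → sumV (replicate m a ++ xs) ≡ + m * a + sumV xs
sumV-replicate zero    a xs = sym (ℤ.+-identityˡ (sumV xs))
sumV-replicate (suc m) a xs = trans (cong (λ t → a + t) (sumV-replicate m a xs)) (lemma (+ m) a (sumV xs))
  where
  lemma : ∀ m p d → p + (m * p + d) ≡ (+ 1 + m) * p + d
  lemma = solve-∀

allV-replicate : ∀ p m {k a} {xs : Vec ℤ k} → allV p (replicate m a ++ xs) ≡ true → allV p xs ≡ true
allV-replicate p zero    eq = eq
allV-replicate p (suc m) eq = allV-replicate p m (proj₂ (∧-true⁻ eq))

allV-ins : ∀ p m {k} x (ys : Vec ℤ (m ℕ.+ k)) → allV p (ins m x ys) ≡ p x ∧ allV p ys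
allV-ins p zero    x ys       = refl
allV-ins p (suc m) x (y ∷ ys) = trans (cong (p y ∧_) (allV-ins p m x ys)) (swap (p y) (p x) (allV p ys))
  where
  swap : ∀ a b c → a ∧ (b ∧ c) ≡ b ∧ (a ∧ c)
  swap true  b c = refl
  swap false b c = sym (Bool.∧-zeroʳ b)

allV-rot : ∀ p {k} (v : Vec ℤ (23 ℕ.+ k)) → allV p (rot v) ≡ allV p v
allV-rot p (x ∷ xs) = allV-ins p 22 x xs

allEqual : ∀ {k} → (ℤ → ℕ) → ℕ → Vec ℤ k → Bool
allEqual q r = allV (λ t → q t ==ℕ r)

allEqual-rot : ∀ {k} q r (v : Vec ℤ (23 ℕ.+ k)) → allEqual q r v ≡ true → allEqual q r (rot v) ≡ true
allEqual-rot q r v eq = trans (allV-rot (λ t → q t ==ℕ r) v) eq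

-- The membership tests compare residues with that of the first coordinate, which rotation replaces
-- by the second; this lemma allows the exchange.
allEqual-head₁ : ∀ {k} q r x y (v : Vec ℤ k) → allEqual q r (x ∷ y ∷ v) ≡ true → q y ≡ r
allEqual-head₁ q r x y v eq = ⌊⌋-true⁻ (q y ℕ.≟ r) (proj₁ (∧-true⁻ (proj₂ (∧-true⁻ {q x ==ℕ r} eq))))

%ℕ≡0⇒multiple : ∀ z d .{{_ : ℕ.NonZero d}} → ((z %ℕ d) ==ℕ 0) ≡ true → z ≡ (z /ℕ d) * + d
%ℕ≡0⇒multiple z d eq = trans (a≡a%ℕn+[a/ℕn]*n z d)
  (trans (cong (λ r → + r + (z /ℕ d) * + d) (⌊⌋-true⁻ (z %ℕ d ℕ.≟ 0) eq)) (ℤ.+-identityˡ _))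

%ℕ-cong⇒multiple : ∀ x y d .{{_ : ℕ.NonZero d}} → x %ℕ d ≡ y %ℕ d → x ≡ y + (x /ℕ d - y /ℕ d) * + d
%ℕ-cong⇒multiple x y d eq = begin
  x                                                   ≡⟨ a≡a%ℕn+[a/ℕn]*n x d ⟩
  + (x %ℕ d) + (x /ℕ d) * + d                         ≡⟨ cong (λ r → + r + (x /ℕ d) * + d) eq ⟩
  + (y %ℕ d) + (x /ℕ d) * + d                         ≡⟨ lemma (+ (y %ℕ d)) (x /ℕ d) (y /ℕ d) (+ d) ⟩
  + (y %ℕ d) + (y /ℕ d) * + d + (x /ℕ d - y /ℕ d) * + d
    ≡⟨ cong (λ z → z + (x /ℕ d - y /ℕ d) * + d) (a≡a%ℕn+[a/ℕn]*n y d) ⟨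
  y + (x /ℕ d - y /ℕ d) * + d                         ∎
  where
  open ≡-Reasoning
  lemma : ∀ r p q d → r + p * d ≡ r + q * d + (p - q) * d
  lemma = solve-∀

embed₁ : ℤ → ℤ → Vec ℤ 24
embed₁ a b = replicate 23 a ++ b ∷ []

dot-embed₁ : ∀ a b a′ b′ → dot (embed₁ a b) (embed₁ a′ b′) ≡ + 23 * (a * a′) + (b * b′ + + 0)
dot-embed₁ a b a′ b′ = dot-replicate 23 a a′ (b ∷ []) (b′ ∷ [])

bounded? : ∀ n {d} (v : Vec ℤ d) → Dec (All (λ t → ∣ t ∣ ℕ.≤ n) v)
bounded? n = All.all? (λ t → ∣ t ∣ ℕ.≤? n)

isometryα : CyclicIsometry latticeα form₄
isometryα = record
  { scale≢0      = _
  ; ρ            = rot {k = 1}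
  ; ρ^23         = rot^23
  ; ρ-dot        = dot-rot {k = 1}
  ; ρ-box        = rot-box 1
  ; ρ-member     = member
  ; embed        = embed
  ; embed-fixed  = λ x y → refl
  ; embed-dot    = λ x y x′ y′ → trans (dot-embed₁ y (y + + 4 * x) y′ (y′ + + 4 * x′)) (expand x y x′ y′)
  ; embed-onto   = λ v eq fix → let a , rest , v≡ = rot-fixed v fix in onto v a rest v≡ eq
  ; basis-member = λ { zero → refl ; (suc zero) → refl ; (suc (suc zero)) → refl }
  -- 40 is `scale` times `trace2 form-basis`, here 4 · (4 + 6); the bounds 350, 28 and 80 of the
  -- other lattices arise likewise.
  ; basis-bound  = λ { zero → from-yes (bounded? 40 (embed (+ 1) (+ 0)))
                     ; (suc zero) → from-yes (bounded? 40 (embed (+ 0) (+ 1)))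
                     ; (suc (suc zero)) → from-yes (bounded? 40 (embed (+ 0) (+ 0))) }
  }
  where
  embed : ℤ → ℤ → Vec ℤ 24
  -- In the doubled coordinates the basis is 2e₂₄, of norm 4, and the glue vector (½)²⁴, of norm 6.
  embed x y = embed₁ y (y + + 4 * x)

  expand : ∀ x y x′ y′ → + 23 * (y * y′) + ((y + + 4 * x) * (y′ + + 4 * x′) + + 0)
                       ≡ + 4 * (+ 4 * (x * x′) + (x * y′ + y * x′) + + 6 * (y * y′))
  expand = solve-∀

  member : ∀ v → memD24 v ≡ true → memD24 (rot v) ≡ true
  member v@(x₀ ∷ x₁ ∷ xs) eq = let parity , sum = ∧-true⁻ eq in cong₂ _∧_
    (trans (cong (λ r → allEqual (_%ℕ 2) r (rot v)) (allEqual-head₁ (_%ℕ 2) (x₀ %ℕ 2) x₀ x₁ xs parity))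
           (allEqual-rot (_%ℕ 2) (x₀ %ℕ 2) v parity))
    (trans (cong (λ s → (s %ℕ 4) ==ℕ 0) (sumV-rot v)) sum)

  onto : ∀ v a rest → v ≡ replicate 23 a ++ rest → memD24 v ≡ true → ∃₂ λ x y → v ≡ embed x y
  onto _ a (b ∷ []) refl eq =
    -- The coordinate sum `23 a + b = 4 t` gives `b = a + 4 (t - 6 a)`, because -23 = 1 - 24.
    t - + 6 * a , a , cong (embed₁ a) (lastCoordinate a b t
      (trans (sym (sumV-replicate 23 a (b ∷ []))) (%ℕ≡0⇒multiple (sumV (embed₁ a b)) 4 (proj₂ (∧-true⁻ eq)))))
    where
    t = sumV (embed₁ a b) /ℕ 4
    lastCoordinate : ∀ a b t → + 23 * a + (b + + 0) ≡ t * + 4 → b ≡ a + + 4 * (t - + 6 * a)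
    lastCoordinate a b t eq = trans (isolate a b) (trans (cong (_- + 23 * a) eq) (collect a t))
      where
      isolate : ∀ a b → b ≡ + 23 * a + (b + + 0) - + 23 * a
      isolate = solve-∀
      collect : ∀ a t → t * + 4 - + 23 * a ≡ a + + 4 * (t - + 6 * a)
      collect = solve-∀

isometryδ : CyclicIsometry latticeδ form₂
isometryδ = record
  { scale≢0      = _
  ; ρ            = rot {k = 2}
  ; ρ^23         = rot^23
  ; ρ-dot        = dot-rot {k = 2}
  ; ρ-box        = rot-box 2
  ; ρ-member     = member
  ; embed        = embed
  ; embed-fixed  = λ x y → refl
  ; embed-dot    = λ x y x′ y′ → trans (dot-replicate 23 y y′ (tail x y) (tail x′ y′)) (expand x y x′ y′)
  ; embed-onto   = λ v eq fix → let a , rest , v≡ = rot-fixed v fix in onto v a rest v≡ eq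
  ; basis-member = λ { zero → refl ; (suc zero) → refl ; (suc (suc zero)) → refl }
  ; basis-bound  = λ { zero → from-yes (bounded? 350 (embed (+ 1) (+ 0)))
                     ; (suc zero) → from-yes (bounded? 350 (embed (+ 0) (+ 1)))
                     ; (suc (suc zero)) → from-yes (bounded? 350 (embed (+ 0) (+ 0))) }
  }
  where
  tail : ℤ → ℤ → Vec ℤ 2
  -- The first basis vector is the root (0²³, 5, -5). The second, (1²³, -9, -14), has zero sum and
  -- all entries 1 modulo 5; its norm is 300/25 = 12, and its product with the root is 25/25 = 1.
  tail x y = + 5 * x - + 9 * y ∷ - (+ 5 * x) - + 14 * y ∷ []

  embed : ℤ → ℤ → Vec ℤ 25
  embed x y = replicate 23 y ++ tail x y

  expand : ∀ x y x′ y′ → + 23 * (y * y′) + ((+ 5 * x - + 9 * y) * (+ 5 * x′ - + 9 * y′)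
                           + ((- (+ 5 * x) - + 14 * y) * (- (+ 5 * x′) - + 14 * y′) + + 0))
                       ≡ + 25 * (+ 2 * (x * x′) + (x * y′ + y * x′) + + 12 * (y * y′))
  expand = solve-∀

  member : ∀ v → memA24 v ≡ true → memA24 (rot v) ≡ true
  member v@(x₀ ∷ x₁ ∷ xs) eq = let sum , residue = ∧-true⁻ eq in cong₂ _∧_
    (trans (cong (_==ℤ + 0) (sumV-rot v)) sum)
    (trans (cong (λ r → allEqual (_%ℕ 5) r (rot v)) (allEqual-head₁ (_%ℕ 5) (x₀ %ℕ 5) x₀ x₁ xs residue))
           (allEqual-rot (_%ℕ 5) (x₀ %ℕ 5) v residue))

  onto : ∀ v a rest → v ≡ replicate 23 a ++ rest → memA24 v ≡ true → ∃₂ λ x y → v ≡ embed x y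
  onto _ a (b ∷ c ∷ []) refl eq =
    -- From `b = a + 5 k` and `a = 10 a - 9 a` one gets `b = 5 (k + 2 a) - 9 a`; the zero sum then
    -- determines `c`.
    k + + 2 * a , a , cong (replicate 23 a ++_) (cong₂ (λ b c → b ∷ c ∷ []) b≡ (lastCoordinate a b c k sum b≡))
    where
    k = b /ℕ 5 - a /ℕ 5
    sum : + 23 * a + (b + (c + + 0)) ≡ + 0
    sum = trans (sym (sumV-replicate 23 a (b ∷ c ∷ [])))
      (⌊⌋-true⁻ (sumV (replicate 23 a ++ b ∷ c ∷ []) ℤ.≟ + 0) (proj₁ (∧-true⁻ eq)))
    b≡a : b %ℕ 5 ≡ a %ℕ 5
    b≡a = ⌊⌋-true⁻ (b %ℕ 5 ℕ.≟ a %ℕ 5)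
      (proj₁ (∧-true⁻ (allV-replicate (λ t → (t %ℕ 5) ==ℕ (a %ℕ 5)) 23 {a = a} {b ∷ c ∷ []}
        (proj₂ (∧-true⁻ {sumV (replicate 23 a ++ b ∷ c ∷ []) ==ℤ + 0} eq)))))
    shift : ∀ a k → a + k * + 5 ≡ + 5 * (k + + 2 * a) - + 9 * a
    shift = solve-∀
    b≡ : b ≡ + 5 * (k + + 2 * a) - + 9 * a
    b≡ = trans (%ℕ-cong⇒multiple b a 5 b≡a) (shift a k)
    lastCoordinate : ∀ a b c k → + 23 * a + (b + (c + + 0)) ≡ + 0 → b ≡ + 5 * (k + + 2 * a) - + 9 * a →
                     c ≡ - (+ 5 * (k + + 2 * a)) - + 14 * a
    lastCoordinate a b c k sum refl = trans (isolate a c k) (trans (cong (_- _) sum) (collect a k))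
      where
      isolate : ∀ a c k → c ≡ + 23 * a + ((+ 5 * (k + + 2 * a) - + 9 * a) + (c + + 0))
                              - (+ 23 * a + (+ 5 * (k + + 2 * a) - + 9 * a))
      isolate = solve-∀
      collect : ∀ a k → + 0 - (+ 23 * a + (+ 5 * (k + + 2 * a) - + 9 * a)) ≡ - (+ 5 * (k + + 2 * a)) - + 14 * a
      collect = solve-∀

isometryψ : CyclicIsometry latticeψ form₂
isometryψ = record
  { scale≢0      = _
  ; ρ            = rot {k = 1}
  ; ρ^23         = rot^23
  ; ρ-dot        = dot-rot {k = 1}
  ; ρ-box        = rot-box 1
  ; ρ-member     = member
  ; embed        = embed
  ; embed-fixed  = λ x y → refl
  ; embed-dot    = λ x y x′ y′ → trans (dot-embed₁ y (y + x * + 2) y′ (y′ + x′ * + 2)) (expand x y x′ y′)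
  ; embed-onto   = λ v eq fix → let a , rest , v≡ = rot-fixed v fix in onto v a rest v≡ eq
  ; basis-member = λ { zero → refl ; (suc zero) → refl ; (suc (suc zero)) → refl }
  ; basis-bound  = λ { zero → from-yes (bounded? 28 (embed (+ 1) (+ 0)))
                     ; (suc zero) → from-yes (bounded? 28 (embed (+ 0) (+ 1)))
                     ; (suc (suc zero)) → from-yes (bounded? 28 (embed (+ 0) (+ 0))) }
  }
  where
  embed : ℤ → ℤ → Vec ℤ 24
  -- The basis is the root (0²³, 2), of norm 4/2, and the all-ones vector, of norm 24/2.
  embed x y = embed₁ y (y + x * + 2)

  expand : ∀ x y x′ y′ → + 23 * (y * y′) + ((y + x * + 2) * (y′ + x′ * + 2) + + 0)
                       ≡ + 2 * (+ 2 * (x * x′) + (x * y′ + y * x′) + + 12 * (y * y′))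
  expand = solve-∀

  member : ∀ v → memA1 v ≡ true → memA1 (rot v) ≡ true
  member v eq = golay-map-rot (λ t → (t %ℕ 2) ==ℕ 1) v eq

  odd-injective : ∀ r s → r ℕ.< 2 → s ℕ.< 2 → (r ==ℕ 1) ≡ (s ==ℕ 1) → r ≡ s
  odd-injective 0 0 _ _ _ = refl
  odd-injective 1 1 _ _ _ = refl
  odd-injective 0 1 _ _ ()
  odd-injective 1 0 _ _ ()
  odd-injective (suc (suc _)) _ (s≤s (s≤s ())) _ _
  odd-injective _ (suc (suc _)) _ (s≤s (s≤s ())) _

  onto : ∀ v a rest → v ≡ replicate 23 a ++ rest → memA1 v ≡ true → ∃₂ λ x y → v ≡ embed x y
  onto v a (b ∷ []) v≡ eq =
    b /ℕ 2 - a /ℕ 2 , a , trans v≡ (cong (embed₁ a) (%ℕ-cong⇒multiple b a 2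
      (sym (odd-injective (a %ℕ 2) (b %ℕ 2) (n%ℕd<d a 2) (n%ℕd<d b 2)
        (golay-map-constant (λ t → (t %ℕ 2) ==ℕ 1) v a b v≡ eq)))))

isometryω : CyclicIsometry latticeω form₄
isometryω = record
  { scale≢0      = _
  ; ρ            = rot {k = 1}
  ; ρ^23         = rot^23
  ; ρ-dot        = dot-rot {k = 1}
  ; ρ-box        = rot-box 1
  ; ρ-member     = member
  ; embed        = embed
  ; embed-fixed  = λ x y → refl
  ; embed-dot    = λ x y x′ y′ → trans (dot-embed₁ (x + y) (+ 5 * y - + 3 * x) (x′ + y′) (+ 5 * y′ - + 3 * x′))
                                       (expand x y x′ y′)
  ; embed-onto   = λ v eq fix → let a , rest , v≡ = rot-fixed v fix in onto v a rest v≡ eq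
  ; basis-member = λ { zero → refl ; (suc zero) → refl ; (suc (suc zero)) → refl }
  ; basis-bound  = λ { zero → from-yes (bounded? 80 (embed (+ 1) (+ 0)))
                     ; (suc zero) → from-yes (bounded? 80 (embed (+ 0) (+ 1)))
                     ; (suc (suc zero)) → from-yes (bounded? 80 (embed (+ 0) (+ 0))) }
  }
  where
  embed : ℤ → ℤ → Vec ℤ 24
  -- The basis is (1²³, -3), a minimal vector of norm 32/8 = 4, and (1²³, 5), of norm 48/8 = 6;
  -- their product is (23 - 15)/8 = 1.
  embed x y = embed₁ (x + y) (+ 5 * y - + 3 * x)

  expand : ∀ x y x′ y′ → + 23 * ((x + y) * (x′ + y′)) + ((+ 5 * y - + 3 * x) * (+ 5 * y′ - + 3 * x′) + + 0)
                       ≡ + 8 * (+ 4 * (x * x′) + (x * y′ + y * x′) + + 6 * (y * y′))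
  expand = solve-∀

  bit : ℕ → ℤ → Bool
  bit m t = ((t - + m) %ℕ 4) ==ℕ 2

  -- The body of `memLeech` with the parity `m` as a parameter, so that the parity read off the new
  -- head can be replaced by the old one.
  leech : ℕ → Vec ℤ 24 → Bool
  leech m v = allEqual (_%ℕ 2) m v
            ∧ (((sumV v - + (4 ℕ.* m)) %ℕ 8) ==ℕ 0) ∧ inGolay (toList (Vec.map (bit m) v))

  member : ∀ v → memLeech v ≡ true → memLeech (rot v) ≡ true
  member v@(x₀ ∷ x₁ ∷ xs) eq = let parity , rest = ∧-true⁻ eq
                                   sum , code = ∧-true⁻ rest
                                   m = x₀ %ℕ 2 in
    trans (cong (λ m → leech m (rot v)) (allEqual-head₁ (_%ℕ 2) m x₀ x₁ xs parity))
      (cong₂ _∧_ (allEqual-rot (_%ℕ 2) m v parity) (cong₂ _∧_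
        (trans (cong (λ s → ((s - + (4 ℕ.* m)) %ℕ 8) ==ℕ 0) (sumV-rot v)) sum)
        (trans (cong (inGolay ∘ toList) (map-rot (bit m) v)) (golay-rot (Vec.map (bit m) v) code))))

  onto : ∀ v a rest → v ≡ replicate 23 a ++ rest → memLeech v ≡ true → ∃₂ λ x y → v ≡ embed x y
  onto _ a (b ∷ []) refl eq =
    x , a - x , cong₂ embed₁ (split a x) (lastCoordinate a b (+ m) (a /ℕ 2) t (a≡a%ℕn+[a/ℕn]*n a 2)
      (trans (cong₂ _-_ (sym (sumV-replicate 23 a (b ∷ []))) (sym (ℤ.pos-* 4 m)))
        (%ℕ≡0⇒multiple (sumV (embed₁ a b) - + (4 ℕ.* m)) 8
          (proj₁ (∧-true⁻ (proj₂ (∧-true⁻ {allEqual (_%ℕ 2) m (embed₁ a b)} eq)))))))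
    where
    m = a %ℕ 2
    t = (sumV (embed₁ a b) - + (4 ℕ.* m)) /ℕ 8
    -- An embedded vector has `b = 5 a - 8 x`. Substituting `a = m + 2 q`, with `q = a /ℕ 2`, and
    -- `b = 8 t + 4 m - 23 a` gives `8 x = 24 m + 56 q - 8 t`.
    x = + 3 * + m + + 7 * (a /ℕ 2) - t
    split : ∀ a x → a ≡ x + (a - x)
    split = solve-∀
    lastCoordinate : ∀ a b m q t → a ≡ m + q * + 2 → + 23 * a + (b + + 0) - + 4 * m ≡ t * + 8 →
      b ≡ + 5 * (a - (+ 3 * m + + 7 * q - t)) - + 3 * (+ 3 * m + + 7 * q - t)
    lastCoordinate _ b m q t refl eq = trans (isolate m q b) (trans (cong (λ s → s - _) eq) (collect m q t))
      where
      isolate : ∀ m q b → b ≡ + 23 * (m + q * + 2) + (b + + 0) - + 4 * m - (+ 23 * (m + q * + 2) - + 4 * m)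
      isolate = solve-∀
      collect : ∀ m q t → t * + 8 - (+ 23 * (m + q * + 2) - + 4 * m)
        ≡ + 5 * (m + q * + 2 - (+ 3 * m + + 7 * q - t)) - + 3 * (+ 3 * m + + 7 * q - t)
      collect = solve-∀

theorem8 : (ThetaOpVanishesMod 23 latticeα 2 × ThetaOpVanishesMod 23 latticeδ 2
    × ThetaOpVanishesMod 23 latticeψ 2 × ThetaOpVanishesMod 23 latticeω 2)
    × (SingularModWithMaxRank 23 latticeα 3 2 × SingularModWithMaxRank 23 latticeδ 3 2
    × SingularModWithMaxRank 23 latticeψ 3 2 × SingularModWithMaxRank 23 latticeω 3 2)
theorem8 =
  (thetaOpVanishes isometryα , thetaOpVanishes isometryδ , thetaOpVanishes isometryψ , thetaOpVanishes isometryω) ,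
  (singular isometryα , singular isometryδ , singular isometryψ , singular isometryω)
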